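{- For every integer $r\ge 4$ there is a constant $c_r$ such that every graph $G$ with maximum degree $\Delta\ge 3$ satisfies $A_r^l(G)\le \Delta^{\lfloor r/2\rfloor} + c_r\Delta^{(r+1)/3}$; that is, $A_r^l(G)\le \Delta^{\lfloor r/2\rfloor} + O(\Delta^{(r+1)/3})$.
   Context: For an integer $r\ge 3$, an $r$-acyclic vertex-coloring of a graph is a proper vertex-coloring in which every cycle $C$ uses at least $\min(|C|,r)$ colors. $A_r^l(G)$, the $r$-acyclic choice number, is the minimum $k$ such that for every assignment of lists of size at least $k$ to the vertices, $G$ has an $r$-acyclic coloring with each vertex colored from its list. -}

module Defs where

open import Data.Fin using (Fin)
open import Data.List using (List; []; _∷_; _++_; allFin; deduplicate; filter; length; map)
open import Data.List.Extrema.Nat using (max)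
open import Data.List.Membership.Propositional using (_∈_)
open import Data.List.Relation.Unary.Linked using (Linked)
open import Data.List.Relation.Unary.Unique.Propositional using (Unique)
open import Data.Nat using (ℕ; NonZero; _≤_; _*_; _^_; _⊓_; _≟_)
open import Data.Product using (_×_; ∃-syntax)
open import Level using (0ℓ)
open import Relation.Binary.Core using (Rel)
open import Relation.Binary.Definitions using (Decidable; Irreflexive; Symmetric)
open import Relation.Binary.PropositionalEquality using (_≡_; _≢_)

record Graph : Set₁ where
  field
    order      : ℕ
    Adj        : Rel (Fin order) 0ℓ
    adj?       : Decidable Adj
    adj-sym    : Symmetric Adj
    adj-irrefl : Irreflexive _≡_ Adj

  Vertex : Set
  Vertex = Fin order

  degree : Vertex → ℕ
  degree v = length (filter (adj? v) (allFin order))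

  maxDegree : ℕ
  maxDegree = max 0 (map degree (allFin order))

open Graph public using (Vertex; maxDegree)

-- A cycle is listed from an arbitrary starting vertex in a chosen direction,
-- so each cycle subgraph is represented by several elements of this type.
record Cycle (G : Graph) : Set where
  open Graph G using (Adj)
  field
    start : Vertex G
    rest  : List (Vertex G)

  vertices : List (Vertex G)
  vertices = start ∷ rest

  field
    3≤length : 3 ≤ length vertices
    distinct : Unique vertices
    closed   : Linked Adj (vertices ++ start ∷ [])

-- Number of distinct entries, i.e. the size of a list regarded as a set.
card : List ℕ → ℕ
card xs = length (deduplicate _≟_ xs)

Coloring : Graph → Set
Coloring G = Vertex G → ℕ

IsProper : (G : Graph) → Coloring G → Set
IsProper G f = ∀ {u v} → Graph.Adj G u v → f u ≢ f v

IsAcyclicColoring : ℕ → (G : Graph) → Coloring G → Set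
IsAcyclicColoring r G f =
  IsProper G f ×
  (∀ (C : Cycle G) → let open Cycle C in
     length vertices ⊓ r ≤ card (map f vertices))

IsAcyclicChoosable : ℕ → Graph → ℕ → Set
IsAcyclicChoosable r G k =
  (L : Vertex G → List ℕ) → (∀ v → k ≤ card (L v)) →
  ∃[ f ] (∀ v → f v ∈ L v) × IsAcyclicColoring r G f

IsMinimum : (ℕ → Set) → ℕ → Set
IsMinimum P k = P k × (∀ j → P j → k ≤ j)

IsAcyclicChoiceNumber : ℕ → Graph → ℕ → Set
IsAcyclicChoiceNumber r G = IsMinimum (IsAcyclicChoosable r G)

-- The real inequality t ≤ c · d^(p/q), with both sides raised to the q-th
-- power; equivalent because both sides are nonnegative and q > 0.
_≲_·_^[_/_] : (t c d p q : ℕ) → .{{NonZero q}} → Set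
t ≲ c · d ^[ p / q ] = t ^ q ≤ c ^ q * d ^ p

{-# OPTIONS --safe #-}
module Submission where

-- Let b³ lie between Δ^(r+1) and 8 Δ^(r+1).  Each vertex v gets a set of at most Δ^⌊r/2⌋ + 2b forbidden
-- partners, whose colours must differ from that of v: the vertices within distance ⌊r/2⌋, and those
-- joined to v by more than Δ^⌈r/2⌉ / b walks of length ⌈r/2⌉.  This makes cycles of length at most r
-- rainbow.  What can still go wrong is that two antipodal pairs of an (r+1)-cycle have equal colours, or
-- that three equalities hold on a path with r + 2 vertices; every longer cycle contains such a path.
-- At v there are O(b²) antipodal configurations, because v and its antipode are joined by few walks, and
-- O(b³) paths.  By Rosenfeld's counting argument each vertex multiplies the number of valid colourings by
-- at least b, so a configuration with j equations besides the one at v has weight b^-j, and the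
-- configurations of both types rule out O(b) colours of v on average.
-- A least admissible list length exists constructively because choosability is decidable.

open import Data.Empty using (⊥)
open import Data.Fin using (Fin; zero; suc; toℕ)
import Data.Fin.Properties as Fin
open import Data.Fin.Subset using (Subset; _-_; ∣_∣; _∉_; ⁅_⁆) renaming (_∈_ to _∈ₛ_; ⊤ to full)
open import Data.Fin.Subset.Properties
  using (x∈p∧x≢y⇒x∈p-y; x∈p⇒∣p-x∣<∣p∣; p─q⊆p; ⊆-antisym; ∣p─q∣≤∣p∣; ∈⊤) renaming (_∈?_ to _∈ₛ?_)
open import Data.List using (List; []; _∷_; _++_; [_]; map; concatMap; length; filter; allFin; upTo;
  take; deduplicate; lookup; cartesianProduct)
open import Data.List.Extrema.Nat using (xs≤max)
open import Data.List.Membership.Propositional using (_∈_; find; lose)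
open import Data.List.Membership.Propositional.Properties
open import Data.List.Properties using (length-++; length-map; length-take; length-upTo; length-tabulate;
  length-filter; filter-all; filter-none; filter-notAll; map-++; map-∘; map-cong; map-cong-local; take++drop≡id)
open import Data.List.Relation.Binary.Permutation.Propositional using (↭⇒↭ₛ)
open import Data.List.Relation.Binary.Permutation.Propositional.Properties using (shift)
open import Data.List.Relation.Binary.Permutation.Setoid.Properties using (Unique-resp-↭)
open import Data.List.Relation.Binary.Sublist.Heterogeneous using ([]; _∷_; _∷ʳ_)
open import Data.List.Relation.Binary.Sublist.Heterogeneous.Properties using (⊆-filter-Sublist)
open import Data.List.Relation.Binary.Sublist.Propositional using ()
  renaming (_⊆_ to _⊑_; lookup to ⊑-lookup; ⊆-refl to ⊑-refl; ⊆-trans to ⊑-trans)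
open import Data.List.Relation.Binary.Sublist.Propositional.Properties using ()
  renaming (map⁺ to ⊑-map⁺; ++⁺ to ⊑-++⁺; filter-⊆ to filter-⊑)
open import Data.List.Relation.Unary.All using (All; []; _∷_)
import Data.List.Relation.Unary.All as All
open import Data.List.Relation.Unary.AllPairs using ([]; _∷_; allPairs?)
open import Data.List.Relation.Unary.Any using (Any; here; there; any?; index)
open import Data.List.Relation.Unary.Any.Properties using (lookup-index)
open import Data.List.Relation.Unary.Linked using (Linked; []; [-]; _∷_; linked?)
open import Data.List.Relation.Unary.Unique.Propositional using (Unique)
open import Data.List.Relation.Unary.Unique.Propositional.Properties using (allFin⁺)
  renaming (map⁺ to unique-map⁺; take⁺ to unique-take⁺; filter⁺ to unique-filter⁺)
open import Data.Nat using (ℕ; zero; suc; pred; _+_; _*_; _∸_; _^_; _⊓_; _≤_; _<_; z≤n; s≤s; _≟_; _≤?_; _<?_;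
  ⌊_/2⌋; ⌈_/2⌉; NonZero; >-nonZero; ≢-nonZero⁻¹)
open import Data.Nat.Induction using (<-rec)
open import Data.Nat.ListAction using (sum)
open import Data.Nat.Properties hiding (_≟_; _≤?_; _<?_)
open import Data.Nat.Tactic.RingSolver using (solve-∀)
open import Data.Product using (_×_; _,_; ∃-syntax; proj₁; proj₂)
open import Data.Sum using (_⊎_; inj₁; inj₂)
open import Data.Unit using (⊤; tt)
import Data.Vec as Vec
open import Data.Vec.Functional using () renaming (_∷_ to _◂_)
open import Function using (_∘_; id; case_of_)
open import Relation.Binary using (DecidableEquality; tri<; tri≈; tri>)
open import Relation.Binary.PropositionalEquality hiding ([_])
open import Relation.Nullary using (Dec; yes; no; ¬_; contradiction; ¬?; _×-dec_; _→-dec_; map′)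
open import Relation.Unary using (Decidable)
open import Defs

open import Data.List.Membership.DecPropositional _≟_ using (_∈?_)
open import Data.List.Relation.Unary.Unique.DecPropositional.Properties _≟_ using (deduplicate-!)

private variable
  A B : Set

-- Finite sums and uniform random choices

∑ : List A → (A → ℕ) → ℕ
∑ xs g = sum (map g xs)

∑-mono : ∀ (xs : List A) {g h : A → ℕ} → (∀ {x} → x ∈ xs → g x ≤ h x) → ∑ xs g ≤ ∑ xs h
∑-mono []       g≤h = z≤n
∑-mono (x ∷ xs) g≤h = +-mono-≤ (g≤h (here refl)) (∑-mono xs (g≤h ∘ there))

∑-cong : ∀ (xs : List A) {g h : A → ℕ} → (∀ x → g x ≡ h x) → ∑ xs g ≡ ∑ xs h
∑-cong []       g≡h = refl
∑-cong (x ∷ xs) g≡h = cong₂ _+_ (g≡h x) (∑-cong xs g≡h)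

∑-+ : ∀ (xs : List A) (g h : A → ℕ) → ∑ xs (λ x → g x + h x) ≡ ∑ xs g + ∑ xs h
∑-+ []       g h = refl
∑-+ (x ∷ xs) g h rewrite ∑-+ xs g h = +-interchange (g x) (h x) (∑ xs g) (∑ xs h)
  where
  +-interchange : ∀ a b c d → a + b + (c + d) ≡ a + c + (b + d)
  +-interchange = solve-∀

∑-*ˡ : ∀ c (xs : List A) (g : A → ℕ) → ∑ xs (λ x → c * g x) ≡ c * ∑ xs g
∑-*ˡ c []       g = sym (*-zeroʳ c)
∑-*ˡ c (x ∷ xs) g = trans (cong (c * g x +_) (∑-*ˡ c xs g)) (sym (*-distribˡ-+ c (g x) (∑ xs g)))

∑-*ʳ : ∀ c (xs : List A) (g : A → ℕ) → ∑ xs (λ x → g x * c) ≡ ∑ xs g * c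
∑-*ʳ c xs g = trans (∑-cong xs λ x → *-comm (g x) c) (trans (∑-*ˡ c xs g) (*-comm c (∑ xs g)))

∑-const : ∀ (xs : List A) c → ∑ xs (λ _ → c) ≡ length xs * c
∑-const []       c = refl
∑-const (x ∷ xs) c = cong (c +_) (∑-const xs c)

∑-≤ : ∀ (xs : List A) {g : A → ℕ} {c} → (∀ {x} → x ∈ xs → g x ≤ c) → ∑ xs g ≤ length xs * c
∑-≤ xs g≤c = ≤-trans (∑-mono xs g≤c) (≤-reflexive (∑-const xs _))

∑-comm : ∀ (xs : List A) (ys : List B) (g : A → B → ℕ) →
         ∑ xs (λ x → ∑ ys (g x)) ≡ ∑ ys (λ y → ∑ xs (λ x → g x y))
∑-comm []       ys g = sym (trans (∑-const ys 0) (*-zeroʳ (length ys)))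
∑-comm (x ∷ xs) ys g rewrite ∑-comm xs ys g = sym (∑-+ ys (g x) (λ y → ∑ xs (λ x → g x y)))

∑-++ : ∀ (xs ys : List A) (g : A → ℕ) → ∑ (xs ++ ys) g ≡ ∑ xs g + ∑ ys g
∑-++ []       ys g = refl
∑-++ (x ∷ xs) ys g rewrite ∑-++ xs ys g = sym (+-assoc (g x) (∑ xs g) (∑ ys g))

∑-concatMap : ∀ (F : A → List B) (xs : List A) (g : B → ℕ) →
              ∑ (concatMap F xs) g ≡ ∑ xs (λ x → ∑ (F x) g)
∑-concatMap F []       g = refl
∑-concatMap F (x ∷ xs) g =
  trans (∑-++ (F x) (concatMap F xs) g) (cong (∑ (F x) g +_) (∑-concatMap F xs g))

∑-map : ∀ (φ : A → B) (xs : List A) (g : B → ℕ) → ∑ (map φ xs) g ≡ ∑ xs (g ∘ φ)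
∑-map φ []       g = refl
∑-map φ (x ∷ xs) g = cong (g (φ x) +_) (∑-map φ xs g)

length-concatMap : ∀ (F : A → List B) (xs : List A) → length (concatMap F xs) ≡ ∑ xs (length ∘ F)
length-concatMap F []       = refl
length-concatMap F (x ∷ xs) =
  trans (length-++ (F x)) (cong (length (F x) +_) (length-concatMap F xs))

length-concatMap-≤ : ∀ (F : A → List B) (xs : List A) {c} →
                     (∀ {x} → x ∈ xs → length (F x) ≤ c) → length (concatMap F xs) ≤ length xs * c
length-concatMap-≤ F xs F≤c = ≤-trans (≤-reflexive (length-concatMap F xs)) (∑-≤ xs F≤c)

∈⇒≤∑ : ∀ {xs : List A} {x} (g : A → ℕ) → x ∈ xs → g x ≤ ∑ xs g
∈⇒≤∑ g (here refl)        = m≤m+n _ _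
∈⇒≤∑ g (there {x = y} x∈) = ≤-trans (∈⇒≤∑ g x∈) (m≤n+m _ (g y))

∑-positive : ∀ (xs : List A) (g : A → ℕ) → 0 < ∑ xs g → ∃[ x ] x ∈ xs × 0 < g x
∑-positive (x ∷ xs) g 0< with g x in eq
... | suc _ = x , here refl , ≤-trans (s≤s z≤n) (≤-reflexive (sym eq))
... | zero  with ∑-positive xs g 0<
... | y , y∈ , 0<g = y , there y∈ , 0<g

∈-concatMap : ∀ (F : A → List B) {xs : List A} {x y} → x ∈ xs → y ∈ F x → y ∈ concatMap F xs
∈-concatMap F x∈ y∈ = ∈-concatMap⁺ F (lose x∈ y∈)

concatMap-∈ : ∀ (F : A → List B) (xs : List A) {y} → y ∈ concatMap F xs → ∃[ x ] x ∈ xs × y ∈ F x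
concatMap-∈ F xs y∈ = find (∈-concatMap⁻ F {xs = xs} y∈)

ι : ∀ {P : Set} → Dec P → ℕ
ι (yes _) = 1
ι (no _)  = 0

ι-yes : ∀ {P : Set} (d : Dec P) → P → ι d ≡ 1
ι-yes (yes _) p = refl
ι-yes (no ¬p) p = contradiction p ¬p

ι-mono : ∀ {P Q : Set} (d : Dec P) (e : Dec Q) → (P → Q) → ι d ≤ ι e
ι-mono (no _)  e f = z≤n
ι-mono (yes p) e f = ≤-reflexive (sym (ι-yes e (f p)))

ι-cong : ∀ {P Q : Set} (d : Dec P) (e : Dec Q) → (P → Q) → (Q → P) → ι d ≡ ι e
ι-cong d e f g = ≤-antisym (ι-mono d e f) (ι-mono e d g)

ι-≤1 : ∀ {P : Set} (d : Dec P) → ι d ≤ 1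
ι-≤1 d = ι-mono d (yes tt) _

ι-positive : ∀ {P : Set} (d : Dec P) → 0 < ι d → P
ι-positive (yes p) _ = p

∑-ι-≡ : ∀ {A : Set} (_≟_ : DecidableEquality A) (xs : List A) {y} → Unique xs → ∑ xs (λ x → ι (x ≟ y)) ≤ 1
∑-ι-≡ _≟_ []       _ = z≤n
∑-ι-≡ _≟_ (x ∷ xs) {y} (x∉xs ∷ u) with x ≟ y
... | no _     = ∑-ι-≡ _≟_ xs u
... | yes refl = s≤s (≤-reflexive (none xs x∉xs))
  where
  none : ∀ zs → All (x ≢_) zs → ∑ zs (λ z → ι (z ≟ x)) ≡ 0
  none []       _ = refl
  none (z ∷ zs) (x≢z ∷ ps) with z ≟ x
  ... | yes refl = contradiction refl x≢z
  ... | no _     = none zs ps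

Π : ∀ n → (Fin n → List A) → List (Fin n → A)
Π zero    L = [ (λ ()) ]
Π (suc n) L = concatMap (λ a → map (a ◂_) (Π n (L ∘ suc))) (L zero)

Π-sound : ∀ n (L : Fin n → List A) {f : Fin n → A} → f ∈ Π n L → ∀ v → f v ∈ L v
Π-sound (suc n) L f∈ v with concatMap-∈ _ (L zero) f∈
... | a , a∈ , f∈′ with ∈-map⁻ _ f∈′
Π-sound (suc n) L f∈ zero    | a , a∈ , f∈′ | g , g∈ , refl = a∈
Π-sound (suc n) L f∈ (suc v) | a , a∈ , f∈′ | g , g∈ , refl = Π-sound n (L ∘ suc) g∈ v

-- Functions in a list can only be identified pointwise without extensionality, so an enumerated
-- representative of `f` replaces `f` itself.
Π-complete : ∀ n (L : Fin n → List A) {f : Fin n → A} → (∀ v → f v ∈ L v) → ∃[ g ] g ∈ Π n L × (∀ v → g v ≡ f v)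
Π-complete zero    L {f} f∈ = (λ ()) , here refl , λ ()
Π-complete (suc n) L {f} f∈ with Π-complete n (L ∘ suc) {f ∘ suc} (f∈ ∘ suc)
... | g , g∈ , g≡f = (f zero ◂ g) , ∈-concatMap _ (f∈ zero) (∈-map⁺ _ g∈) , λ { zero → refl ; (suc v) → g≡f v }

∑-Π : ∀ n (L : Fin (suc n) → List A) (g : (Fin (suc n) → A) → ℕ) →
      ∑ (Π (suc n) L) g ≡ ∑ (L zero) (λ a → ∑ (Π n (L ∘ suc)) (λ f → g (a ◂ f)))
∑-Π n L g = trans (∑-concatMap _ (L zero) g) (∑-cong (L zero) λ a → ∑-map (a ◂_) (Π n (L ∘ suc)) g)

IgnoresAt : ∀ {n} → Fin n → ((Fin n → ℕ) → ℕ) → Set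
IgnoresAt v g = ∀ f f′ → (∀ u → u ≢ v → f u ≡ f′ u) → g f ≡ g f′

-- Under a uniform choice of f the value f v hits a target independent of it with probability at most 1/k.
∑-Π-hit : ∀ {k} n (L : Fin n → List ℕ) → (∀ v → Unique (L v)) → (∀ v → length (L v) ≡ k) →
          ∀ v g τ → IgnoresAt v g → IgnoresAt v τ →
          k * ∑ (Π n L) (λ f → g f * ι (f v ≟ τ f)) ≤ ∑ (Π n L) g
∑-Π-hit {k} (suc n) L uniq len zero g τ g-ign τ-ign = begin
  k * ∑ (Π (suc n) L) G                   ≡⟨ cong (k *_) (∑-Π n L G) ⟩
  k * ∑ L₀ (λ a → ∑ R (λ f → G (a ◂ f)))  ≡⟨ cong (k *_) (∑-comm L₀ R (λ a f → G (a ◂ f))) ⟩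
  k * ∑ R (λ f → ∑ L₀ (λ a → G (a ◂ f)))  ≡⟨ ∑-*ˡ k R (λ f → ∑ L₀ (λ a → G (a ◂ f))) ⟨
  ∑ R (λ f → k * ∑ L₀ (λ a → G (a ◂ f)))  ≤⟨ ∑-mono R (λ {f} _ → fibre f) ⟩
  ∑ R (λ f → ∑ L₀ (λ a → g (a ◂ f)))      ≡⟨ ∑-comm L₀ R (λ a f → g (a ◂ f)) ⟨
  ∑ L₀ (λ a → ∑ R (λ f → g (a ◂ f)))      ≡⟨ ∑-Π n L g ⟨
  ∑ (Π (suc n) L) g                       ∎
  where
  open ≤-Reasoning
  L₀ = L zero
  R  = Π n (L ∘ suc)
  G  = λ f → g f * ι (f zero ≟ τ f)

  -- The 0 is an arbitrary placeholder: `g` and `τ` are constant along the fibre, so the whole fibre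
  -- can be evaluated at one representative.
  reset : ∀ {h} → IgnoresAt zero h → ∀ a f → h (a ◂ f) ≡ h (0 ◂ f)
  reset ign a f = ign _ _ λ { zero 0≢0 → contradiction refl 0≢0 ; (suc _) _ → refl }

  fibre : ∀ f → k * ∑ L₀ (λ a → G (a ◂ f)) ≤ ∑ L₀ (λ a → g (a ◂ f))
  fibre f = begin
    k * ∑ L₀ (λ a → G (a ◂ f))
      ≡⟨ cong (k *_) (∑-cong L₀ λ a →
           cong₂ _*_ (reset g-ign a f) (cong (λ t → ι (a ≟ t)) (reset τ-ign a f))) ⟩
    k * ∑ L₀ (λ a → g (0 ◂ f) * ι (a ≟ τ (0 ◂ f)))
      ≡⟨ cong (k *_) (∑-*ˡ (g (0 ◂ f)) L₀ (λ a → ι (a ≟ τ (0 ◂ f)))) ⟩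
    k * (g (0 ◂ f) * ∑ L₀ (λ a → ι (a ≟ τ (0 ◂ f))))
      ≤⟨ *-monoʳ-≤ k (*-monoʳ-≤ (g (0 ◂ f)) (∑-ι-≡ _≟_ L₀ (uniq zero))) ⟩
    k * (g (0 ◂ f) * 1)
      ≡⟨ cong₂ _*_ (sym (len zero)) (*-identityʳ _) ⟩
    length L₀ * g (0 ◂ f)
      ≡⟨ ∑-const L₀ (g (0 ◂ f)) ⟨
    ∑ L₀ (λ _ → g (0 ◂ f))
      ≡⟨ ∑-cong L₀ (λ a → reset g-ign a f) ⟨
    ∑ L₀ (λ a → g (a ◂ f)) ∎
∑-Π-hit {k} (suc n) L uniq len (suc v) g τ g-ign τ-ign = begin
  k * ∑ (Π (suc n) L) G                       ≡⟨ cong (k *_) (∑-Π n L G) ⟩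
  k * ∑ (L zero) (λ a → ∑ R (λ f → G (a ◂ f)))  ≡⟨ ∑-*ˡ k (L zero) (λ a → ∑ R (λ f → G (a ◂ f))) ⟨
  ∑ (L zero) (λ a → k * ∑ R (λ f → G (a ◂ f)))
    ≤⟨ ∑-mono (L zero) (λ {a} _ → ∑-Π-hit n (L ∘ suc) (uniq ∘ suc) (len ∘ suc) v
         (λ f → g (a ◂ f)) (λ f → τ (a ◂ f)) (restrict g-ign a) (restrict τ-ign a)) ⟩
  ∑ (L zero) (λ a → ∑ R (λ f → g (a ◂ f)))      ≡⟨ ∑-Π n L g ⟨
  ∑ (Π (suc n) L) g                           ∎
  where
  open ≤-Reasoning
  R = Π n (L ∘ suc)
  G = λ f → g f * ι (f (suc v) ≟ τ f)

  restrict : ∀ {h} → IgnoresAt (suc v) h → ∀ a → IgnoresAt v (λ f → h (a ◂ f))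
  restrict ign a f f′ f≡f′ = ign _ _ λ
    { zero    _   → refl
    ; (suc u) u≢v → f≡f′ u (u≢v ∘ cong suc) }

-- The counting argument

Pairs : ℕ → Set
Pairs n = List (Fin n × Fin n)

-- The equations f t ≡ f s of such a list can be resolved one by one: no t reappears in its own
-- equation or in a later one.
Elim : ∀ {n} → Pairs n → Set
Elim []            = ⊤
Elim ((t , s) ∷ q) = t ≢ s × All (λ (t′ , s′) → t′ ≢ t × s′ ≢ t) q × Elim q

elim? : ∀ {n} (q : Pairs n) → Dec (Elim q)
elim? []            = yes tt
elim? ((t , s) ∷ q) =
  ¬? (t Fin.≟ s) ×-dec All.all? (λ (t′ , s′) → ¬? (t′ Fin.≟ t) ×-dec ¬? (s′ Fin.≟ t)) q ×-dec elim? q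

Sat : ∀ {n} → (Fin n → ℕ) → Pairs n → Set
Sat f = All (λ (t , s) → f t ≡ f s)

χ : ∀ {n} → Pairs n → (Fin n → ℕ) → ℕ
χ []            f = 1
χ ((t , s) ∷ q) f = χ q f * ι (f t ≟ f s)

χ-sat : ∀ {n} (q : Pairs n) {f} → Sat f q → χ q f ≡ 1
χ-sat []            []       = refl
χ-sat ((t , s) ∷ q) (e ∷ es) = cong₂ _*_ (χ-sat q es) (ι-yes (_ ≟ _) e)

χ-ignores : ∀ {n} {v : Fin n} (q : Pairs n) →
            All (λ (t , s) → t ≢ v × s ≢ v) q → IgnoresAt v (χ q)
χ-ignores []            _                     f f′ f≡f′ = refl
χ-ignores ((t , s) ∷ q) ((t≢v , s≢v) ∷ rest) f f′ f≡f′ =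
  cong₂ _*_ (χ-ignores q rest f f′ f≡f′)
            (cong₂ (λ x y → ι (x ≟ y)) (f≡f′ t t≢v) (f≡f′ s s≢v))

x∉p-x : ∀ {n} (p : Subset n) x → x ∉ p - x
x∉p-x (s Vec.∷ p) zero    ()
x∉p-x (s Vec.∷ p) (suc x) (Vec.there x∈) = x∉p-x p x x∈

module Counting
  {n k b : ℕ} (0<b : 0 < b)
  (L : Fin n → List ℕ) (L-unique : ∀ v → Unique (L v)) (L-length : ∀ v → length (L v) ≡ k)
  (Valid : Subset n → (Fin n → ℕ) → Set)
  (valid? : ∀ X f → Dec (Valid X f))
  (valid-∅ : ∀ {X f} → (∀ v → v ∉ X) → Valid X f)
  (valid-delete : ∀ {X f} t → Valid X f → Valid (X - t) f)
  (valid-local : ∀ {X f f′} → (∀ u → u ∈ₛ X → f u ≡ f′ u) → Valid X f → Valid X f′)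
  (kinds : List ℕ) (M : ℕ → ℕ) (room : b + ∑ kinds M ≤ k)
  -- A conflict (s , q) at v stands for the equations f v ≡ f s and Sat f q; its kind is the length of q.
  (conflicts : ℕ → Fin n → List (Fin n × Pairs n))
  (conflicts-length : ∀ j v {s q} → (s , q) ∈ conflicts j v → length q ≡ j)
  (conflicts-few : ∀ j v → length (conflicts j v) ≤ M j * b ^ j)
  (conflict : ∀ {X v f} → v ∈ₛ X → Valid (X - v) f → ¬ Valid X f →
     ∃[ j ] ∃[ s ] ∃[ q ] j ∈ kinds × (s , q) ∈ conflicts j v × Elim ((v , s) ∷ q) × Sat f ((v , s) ∷ q))
  where

  Fs : List (Fin n → ℕ)
  Fs = Π n L

  -- All counted colourings are total. By `valid-local` the vertices outside `X` are free, so the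
  -- number of valid partial colourings of `X` is `N X` divided by one factor `k` for each vertex
  -- outside `X`.
  N : Subset n → ℕ
  N X = ∑ Fs (λ f → ι (valid? X f))

  NΧ : Subset n → Pairs n → ℕ
  NΧ X q = ∑ Fs (λ f → ι (valid? X f) * χ q f)

  instance
    b≢0 : NonZero b
    b≢0 = >-nonZero 0<b
    k≢0 : NonZero k
    k≢0 = >-nonZero (≤-trans 0<b (≤-trans (m≤m+n b _) room))

  valid-ignores : ∀ {X v} → v ∉ X → IgnoresAt v (λ f → ι (valid? X f))
  valid-ignores {X} {v} v∉X f f′ f≡f′ =
    ι-cong (valid? X f) (valid? X f′) (valid-local eq) (valid-local λ u u∈ → sym (eq u u∈))
    where
    eq : ∀ u → u ∈ₛ X → f u ≡ f′ u
    eq u u∈X = f≡f′ u λ { refl → v∉X u∈X }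

  delete-absent : ∀ {X t} → t ∉ X → N (X - t) ≤ N X
  delete-absent {X} {t} t∉X = ≤-reflexive (cong N (⊆-antisym (p─q⊆p X ⁅ t ⁆)
    λ u∈X → x∈p∧x≢y⇒x∈p-y u∈X λ { refl → t∉X u∈X }))

  -- Since `t` is outside `X` and does not occur in `q`, neither the validity nor the remaining
  -- equations depend on `f t`; the target `f s` does not either. So the first equation holds with
  -- probability at most 1/k.
  resolve : ∀ {X t s q} → t ∉ X → Elim ((t , s) ∷ q) → k * NΧ X ((t , s) ∷ q) ≤ NΧ X q
  resolve {X} {t} {s} {q} t∉X (t≢s , fresh , _) = begin
    k * NΧ X ((t , s) ∷ q)
      ≡⟨ cong (k *_) (∑-cong Fs λ f → sym (*-assoc (ι (valid? X f)) (χ q f) (ι (f t ≟ f s)))) ⟩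
    k * ∑ Fs (λ f → ι (valid? X f) * χ q f * ι (f t ≟ f s))
      ≤⟨ ∑-Π-hit n L L-unique L-length t _ (λ f → f s) ignores (λ f f′ f≡f′ → f≡f′ s (t≢s ∘ sym)) ⟩
    NΧ X q ∎
    where
    open ≤-Reasoning
    ignores : IgnoresAt t (λ f → ι (valid? X f) * χ q f)
    ignores f f′ f≡f′ = cong₂ _*_ (valid-ignores t∉X f f′ f≡f′) (χ-ignores q fresh f f′ f≡f′)

  -- For `t` in `X` and in terms of partial colourings, this says that admitting `t` multiplies
  -- their number by at least `b`. The size bound makes it usable as an induction hypothesis.
  Growth : ℕ → Set
  Growth m = ∀ X → ∣ X ∣ ≤ m → ∀ t → b * N (X - t) ≤ k * N X

  delete-size : ∀ (X : Subset n) t {m} → ∣ X ∣ ≤ m → ∣ X - t ∣ ≤ m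
  delete-size X t ∣X∣≤m with t ∈ₛ? X
  ... | yes t∈X = <⇒≤ (<-≤-trans (x∈p⇒∣p-x∣<∣p∣ {p = X} t∈X) ∣X∣≤m)
  ... | no  t∉X = ≤-trans (∣p─q∣≤∣p∣ X ⁅ t ⁆) ∣X∣≤m

  -- Each equation has weight at most 1/b. Removing `t` from `X` only enlarges the count, then
  -- `resolve` gains a factor 1/k, and returning from `X - t` to `X` costs at most k/b by `Growth`.
  NΧ-small : ∀ {m} → Growth m → ∀ X → ∣ X ∣ ≤ m → ∀ q → Elim q → b ^ length q * NΧ X q ≤ N X
  NΧ-small growth X ∣X∣≤m [] _ = ≤-reflexive
    (trans (*-identityˡ _) (∑-cong Fs λ f → *-identityʳ (ι (valid? X f))))
  NΧ-small growth X ∣X∣≤m ((t , s) ∷ q) elim@(_ , _ , elim-q) = *-cancelˡ-≤ k (begin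
    k * (b * b ^ length q * NΧ X ((t , s) ∷ q))    ≡⟨ rearrange k b (b ^ length q) (NΧ X ((t , s) ∷ q)) ⟩
    b * (b ^ length q * (k * NΧ X ((t , s) ∷ q)))
      ≤⟨ *-monoʳ-≤ b (*-monoʳ-≤ (b ^ length q) (*-monoʳ-≤ k (∑-mono Fs λ {f} _ →
           *-monoˡ-≤ (χ ((t , s) ∷ q) f) (ι-mono (valid? X f) (valid? (X - t) f) (valid-delete t))))) ⟩
    b * (b ^ length q * (k * NΧ (X - t) ((t , s) ∷ q)))
      ≤⟨ *-monoʳ-≤ b (*-monoʳ-≤ (b ^ length q) (resolve (x∉p-x X t) elim)) ⟩
    b * (b ^ length q * NΧ (X - t) q)
      ≤⟨ *-monoʳ-≤ b (NΧ-small growth (X - t) (delete-size X t ∣X∣≤m) q elim-q) ⟩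
    b * N (X - t)                                  ≤⟨ growth X ∣X∣≤m t ⟩
    k * N X                                        ∎)
    where
    open ≤-Reasoning
    rearrange : ∀ k b c e → k * (b * c * e) ≡ b * (c * (k * e))
    rearrange = solve-∀

  Good : Fin n → Fin n × Pairs n → Set
  Good v (s , q) = Elim ((v , s) ∷ q)

  good? : ∀ v p → Dec (Good v p)
  good? v (s , q) = elim? ((v , s) ∷ q)

  loss : Subset n → Fin n → ℕ → ℕ
  loss X v j = ∑ (filter (good? v) (conflicts j v)) (λ (s , q) → NΧ (X - v) ((v , s) ∷ q))

  -- The equation at `v` gains 1/k because `v` is outside `X - v`; the other `j` equations gain 1/b
  -- each. The latter cancels the factor `b ^ j` in the number of conflicts.
  loss-bound : ∀ {m} → Growth m → ∀ X v → ∣ X - v ∣ ≤ m → ∀ j →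
               k * loss X v j ≤ M j * N (X - v)
  loss-bound growth X v small j = *-cancelˡ-≤ (b ^ j) {{m^n≢0 b j}} (begin
    b ^ j * (k * loss X v j)
      ≡⟨ cong (b ^ j *_) (∑-*ˡ k ps weight) ⟨
    b ^ j * ∑ ps (λ p → k * weight p)
      ≡⟨ ∑-*ˡ (b ^ j) ps (λ p → k * weight p) ⟨
    ∑ ps (λ p → b ^ j * (k * weight p))
      ≤⟨ ∑-≤ ps (λ {p} p∈ → each p (∈-filter⁻ (good? v) p∈)) ⟩
    length ps * N (X - v)
      ≤⟨ *-monoˡ-≤ (N (X - v)) (≤-trans (length-filter (good? v) (conflicts j v)) (conflicts-few j v)) ⟩
    M j * b ^ j * N (X - v)
      ≡⟨ rearrange (M j) (b ^ j) (N (X - v)) ⟩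
    b ^ j * (M j * N (X - v)) ∎)
    where
    open ≤-Reasoning
    ps = filter (good? v) (conflicts j v)
    weight : Fin n × Pairs n → ℕ
    weight (s , q) = NΧ (X - v) ((v , s) ∷ q)
    rearrange : ∀ m c e → m * c * e ≡ c * (m * e)
    rearrange = solve-∀
    each : ∀ p → p ∈ conflicts j v × Good v p → b ^ j * (k * weight p) ≤ N (X - v)
    each (s , q) (p∈ , elim@(_ , _ , elim-q)) rewrite sym (conflicts-length j v p∈) =
      ≤-trans (*-monoʳ-≤ (b ^ length q) (resolve (x∉p-x X v) elim))
              (NΧ-small growth (X - v) small q elim-q)

  -- A union bound: a colouring that is valid on `X - v` but not on `X` exhibits at least one of the
  -- conflicts at `v`.
  split-loss : ∀ X v → v ∈ₛ X → N (X - v) ≤ N X + ∑ kinds (loss X v)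
  split-loss X v v∈X = begin
    N (X - v)
      ≤⟨ ∑-mono Fs (λ {f} _ → pointwise f) ⟩
    ∑ Fs (λ f → ι (valid? X f) + ∑ kinds (λ j → ∑ (ps j) (term f)))
      ≡⟨ ∑-+ Fs _ _ ⟩
    N X + ∑ Fs (λ f → ∑ kinds (λ j → ∑ (ps j) (term f)))
      ≡⟨ cong (N X +_) (trans (∑-comm Fs kinds _) (∑-cong kinds λ j → ∑-comm Fs (ps j) term)) ⟩
    N X + ∑ kinds (loss X v) ∎
    where
    open ≤-Reasoning
    ps : ℕ → List (Fin n × Pairs n)
    ps j = filter (good? v) (conflicts j v)
    term : (Fin n → ℕ) → Fin n × Pairs n → ℕ
    term f (s , q) = ι (valid? (X - v) f) * χ ((v , s) ∷ q) f

    pointwise : ∀ f → ι (valid? (X - v) f) ≤ ι (valid? X f) + ∑ kinds (λ j → ∑ (ps j) (term f))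
    pointwise f with valid? (X - v) f in eq | valid? X f
    ... | no _      | _         = z≤n
    ... | yes _     | yes _     = s≤s z≤n
    ... | yes valid | no ¬valid with conflict v∈X valid ¬valid
    ... | j , s , q , j∈ , p∈ , elim , sat = begin
      1                                       ≡⟨ χ-sat ((v , s) ∷ q) sat ⟨
      χ ((v , s) ∷ q) f                       ≡⟨ *-identityˡ _ ⟨
      1 * χ ((v , s) ∷ q) f                   ≡⟨ cong (λ d → ι d * χ ((v , s) ∷ q) f) eq ⟨
      term f (s , q)                          ≤⟨ ∈⇒≤∑ (term f) (∈-filter⁺ (good? v) p∈ elim) ⟩
      ∑ (ps j) (term f)                       ≤⟨ ∈⇒≤∑ (λ j → ∑ (ps j) (term f)) j∈ ⟩
      ∑ kinds (λ j → ∑ (ps j) (term f))       ∎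

  growth : ∀ m → Growth m
  grow : ∀ {m} → Growth m → ∀ X t → t ∈ₛ X → ∣ X - t ∣ ≤ m → b * N (X - t) ≤ k * N X

  growth m X ∣X∣≤m t with t ∈ₛ? X
  -- Deleting an absent vertex changes nothing, and `b ≤ k` follows from `room`.
  growth m X ∣X∣≤m t | no t∉X =
    *-mono-≤ (≤-trans (m≤m+n b _) room) (delete-absent t∉X)
  growth zero    X ∣X∣≤m t | yes t∈X = contradiction (≤-trans (x∈p⇒∣p-x∣<∣p∣ t∈X) ∣X∣≤m) λ ()
  growth (suc m) X ∣X∣≤m t | yes t∈X =
    grow (growth m) X t t∈X (≤-pred (≤-trans (x∈p⇒∣p-x∣<∣p∣ t∈X) ∣X∣≤m))

  -- The loss is added to both sides rather than subtracted, so that `room` applies and no truncated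
  -- subtraction occurs.
  grow growth-m X t t∈X small = +-cancelʳ-≤ (∑ kinds M * N′) (b * N′) (k * N X) (begin
    b * N′ + ∑ kinds M * N′                 ≡⟨ *-distribʳ-+ N′ b (∑ kinds M) ⟨
    (b + ∑ kinds M) * N′                    ≤⟨ *-monoˡ-≤ N′ room ⟩
    k * N′                                  ≤⟨ *-monoʳ-≤ k (split-loss X t t∈X) ⟩
    k * (N X + ∑ kinds (loss X t))          ≡⟨ *-distribˡ-+ k (N X) (∑ kinds (loss X t)) ⟩
    k * N X + k * ∑ kinds (loss X t)        ≡⟨ cong (k * N X +_) (∑-*ˡ k kinds (loss X t)) ⟨
    k * N X + ∑ kinds (λ j → k * loss X t j)
      ≤⟨ +-monoʳ-≤ (k * N X) (∑-mono kinds λ {j} _ → loss-bound growth-m X t small j) ⟩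
    k * N X + ∑ kinds (λ j → M j * N′)      ≡⟨ cong (k * N X +_) (∑-*ʳ N′ kinds M) ⟩
    k * N X + ∑ kinds M * N′                ∎)
    where
    open ≤-Reasoning
    N′ = N (X - t)

  Π-nonempty : ∃[ f ] f ∈ Fs
  Π-nonempty with Π-complete n L {λ v → pick v .proj₁} (λ v → pick v .proj₂)
    where
    some : ∀ (xs : List ℕ) → length xs ≡ k → ∃[ x ] x ∈ xs
    some (x ∷ xs) _   = x , here refl
    some []       0≡k = contradiction (sym 0≡k) (≢-nonZero⁻¹ k)
    pick : ∀ v → ∃[ x ] x ∈ L v
    pick v = some (L v) (L-length v)
  ... | f , f∈ , _ = f , f∈

  N-positive : ∀ vs X → (∀ {v} → v ∈ₛ X → v ∈ vs) → 0 < N X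
  N-positive [] X X⊆ = ≤-trans
    (≤-reflexive (sym (ι-yes (valid? X _) (valid-∅ λ v v∈ → case X⊆ v∈ of λ ()))))
    (∈⇒≤∑ (λ f → ι (valid? X f)) (Π-nonempty .proj₂))
  N-positive (v ∷ vs) X X⊆ with N X in eq
  ... | suc _ = s≤s z≤n
  ... | zero  = contradiction
    (≤-trans (*-mono-≤ 0<b (N-positive vs (X - v) shrink)) (growth ∣ X ∣ X ≤-refl v))
    (λ 1≤ → contradiction (≤-trans 1≤ (≤-reflexive (trans (cong (k *_) eq) (*-zeroʳ k)))) λ ())
    where
    shrink : ∀ {u} → u ∈ₛ X - v → u ∈ vs
    shrink {u} u∈ with X⊆ (p─q⊆p X ⁅ v ⁆ u∈)
    ... | here refl = contradiction u∈ (x∉p-x X v)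
    ... | there u∈vs = u∈vs

  valid-exists : ∃[ f ] (∀ v → f v ∈ L v) × Valid full f
  valid-exists with ∑-positive Fs _ (N-positive (allFin n) full (λ {v} _ → ∈-allFin v))
  ... | f , f∈ , 0<ι = f , Π-sound n L f∈ , ι-positive (valid? full f) 0<ι

-- Decidability of choosability

unique-⊆-length : ∀ {xs ys : List A} → Unique xs → (∀ {x} → x ∈ xs → x ∈ ys) → length xs ≤ length ys
unique-⊆-length {xs = []} _ _ = z≤n
unique-⊆-length {xs = x ∷ xs} (x∉xs ∷ u) xs⊆ys with ∈-∃++ (xs⊆ys (here refl))
... | as , bs , refl = begin
  suc (length xs)              ≤⟨ s≤s (unique-⊆-length u xs⊆) ⟩
  suc (length (as ++ bs))      ≡⟨ cong suc (length-++ as) ⟩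
  suc (length as + length bs)  ≡⟨ +-suc (length as) (length bs) ⟨
  length as + length (x ∷ bs)  ≡⟨ length-++ as ⟨
  length (as ++ x ∷ bs)        ∎
  where
  open ≤-Reasoning
  xs⊆ : ∀ {y} → y ∈ xs → y ∈ as ++ bs
  xs⊆ y∈xs with ∈-++⁻ as (xs⊆ys (there y∈xs))
  ... | inj₁ y∈as         = ∈-++⁺ˡ y∈as
  ... | inj₂ (there y∈bs) = ∈-++⁺ʳ as y∈bs
  ... | inj₂ (here refl)  = contradiction refl (All.lookup x∉xs y∈xs)

unique-⊆-card : ∀ {xs ys : List ℕ} → Unique xs → (∀ {x} → x ∈ xs → x ∈ ys) → length xs ≤ card ys
unique-⊆-card u xs⊆ys = unique-⊆-length u (∈-deduplicate⁺ _≟_ ∘ xs⊆ys)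

card-⊆ : ∀ {xs ys : List ℕ} → (∀ {x} → x ∈ xs → x ∈ ys) → card xs ≤ card ys
card-⊆ {xs} xs⊆ys = unique-⊆-card (deduplicate-! xs) (xs⊆ys ∘ ∈-deduplicate⁻ _≟_ xs)

card-map : ∀ (ρ : ℕ → ℕ) cs → card (map ρ cs) ≤ card cs
card-map ρ cs = ≤-trans (unique-⊆-length (deduplicate-! (map ρ cs)) ⊆-image)
                        (≤-reflexive (length-map ρ (deduplicate _≟_ cs)))
  where
  ⊆-image : ∀ {x} → x ∈ deduplicate _≟_ (map ρ cs) → x ∈ map ρ (deduplicate _≟_ cs)
  ⊆-image x∈ with ∈-map⁻ ρ (∈-deduplicate⁻ _≟_ (map ρ cs) x∈)
  ... | c , c∈ , refl = ∈-map⁺ ρ (∈-deduplicate⁺ _≟_ c∈)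

sublist-of-card : ∀ j xs → j ≤ card xs →
                  ∃[ ys ] length ys ≡ j × Unique ys × (∀ {y} → y ∈ ys → y ∈ xs)
sublist-of-card j xs j≤ = take j ds , trans (length-take j ds) (m≤n⇒m⊓n≡m j≤) ,
                          unique-take⁺ j (deduplicate-! xs) ,
                          ∈-deduplicate⁻ _≟_ xs ∘ take-⊆ j ds
  where
  ds = deduplicate _≟_ xs
  take-⊆ : ∀ j (zs : List ℕ) {z} → z ∈ take j zs → z ∈ zs
  take-⊆ (suc j) (z ∷ zs) (here refl) = here refl
  take-⊆ (suc j) (z ∷ zs) (there z∈)  = there (take-⊆ j zs z∈)

listsOf : ℕ → List A → List (List A)
listsOf zero    xs = [ [] ]
listsOf (suc ℓ) xs = concatMap (λ x → map (x ∷_) (listsOf ℓ xs)) xs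

∈-listsOf : ∀ (xs : List A) ys → (∀ {y} → y ∈ ys → y ∈ xs) → ys ∈ listsOf (length ys) xs
∈-listsOf xs []       _     = here refl
∈-listsOf xs (y ∷ ys) ys⊆xs =
  ∈-concatMap _ (ys⊆xs (here refl)) (∈-map⁺ (y ∷_) (∈-listsOf xs ys (ys⊆xs ∘ there)))

-- Strong induction: a bounded search below `k` either finds a smaller solution, which replaces `k`,
-- or certifies that `k` is the minimum.
least : ∀ {P : ℕ → Set} → Decidable P → ∀ k → P k → ∃[ a ] a ≤ k × IsMinimum P a
least {P} P? = <-rec (λ k → P k → ∃[ a ] a ≤ k × IsMinimum P a) step
  where
  step : ∀ k → (∀ {i} → i < k → P i → ∃[ a ] a ≤ i × IsMinimum P a) → P k → ∃[ a ] a ≤ k × IsMinimum P a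
  step k rec Pk with anyUpTo? P? k
  ... | no none = k , ≤-refl , Pk , λ j Pj → ≮⇒≥ λ j<k → none (j , j<k , Pj)
  ... | yes (i , i<k , Pi) with rec i<k Pi
  ... | a , a≤i , min = a , ≤-trans a≤i (<⇒≤ i<k) , min

module _ (G : Graph) where
  open Graph G using (order; Adj; adj?)

  -- The vertices of a cycle are distinct, so its list has at most `order` entries and the search is
  -- finite. `P` sees only the list because the proof fields of a `Cycle` need not be enumerated.
  all-cycles? : ∀ {P : List (Vertex G) → Set} → Decidable P → Dec (∀ (C : Cycle G) → P (Cycle.vertices C))
  all-cycles? {P} P? = map′ to from
    (Fin.all? λ s → All.all? (λ ℓ → All.all? (check? s) (listsOf ℓ (allFin order))) (upTo order))
    where
    IsCycle : Vertex G → List (Vertex G) → Set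
    IsCycle s xs = 3 ≤ length (s ∷ xs) × Unique (s ∷ xs) × Linked Adj ((s ∷ xs) ++ s ∷ [])

    check? : ∀ s xs → Dec (IsCycle s xs → P (s ∷ xs))
    check? s xs = ((3 ≤? length (s ∷ xs)) ×-dec allPairs? (λ x y → ¬? (x Fin.≟ y)) (s ∷ xs)
                   ×-dec linked? adj? ((s ∷ xs) ++ s ∷ [])) →-dec P? (s ∷ xs)

    to : _ → ∀ C → P (Cycle.vertices C)
    to all C = All.lookup (All.lookup (all start) (∈-upTo⁺ short)) (∈-listsOf (allFin order) rest (λ {v} _ → ∈-allFin v))
                 (3≤length , distinct , closed)
      where
      open Cycle C
      short : length rest < order
      short = ≤-trans (unique-⊆-length distinct (λ {v} _ → ∈-allFin v)) (≤-reflexive (length-tabulate id))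

    from : (∀ C → P (Cycle.vertices C)) → _
    from all s = All.tabulate λ _ → All.tabulate λ {xs} _ (3≤ , u , c) →
      all (record { start = s ; rest = xs ; 3≤length = 3≤ ; distinct = u ; closed = c })

  acyclic? : ∀ r f → Dec (IsAcyclicColoring r G f)
  acyclic? r f = proper? ×-dec all-cycles? (λ xs → (length xs ⊓ r) ≤? card (map f xs))
    where
    proper? : Dec (IsProper G f)
    proper? = map′ (λ p {u} {v} → p u v) (λ p u v → p)
      (Fin.all? λ u → Fin.all? λ v → adj? u v →-dec ¬? (f u ≟ f v))

  -- Applying `ρ` keeps equal colours equal and cannot increase the number of colours, so both
  -- requirements pull back from `g` to `f`. With `id` this transports acyclicity along pointwise
  -- equality.
  acyclic-image : ∀ {r f g} (ρ : ℕ → ℕ) → (∀ v → ρ (f v) ≡ g v) →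
                  IsAcyclicColoring r G g → IsAcyclicColoring r G f
  acyclic-image {r} {f} {g} ρ ρf≡g (proper , many) = proper′ , many′
    where
    proper′ : IsProper G f
    proper′ {u} {v} uv fu≡fv = proper uv (trans (sym (ρf≡g u)) (trans (cong ρ fu≡fv) (ρf≡g v)))
    many′ : ∀ C → length (Cycle.vertices C) ⊓ r ≤ card (map f (Cycle.vertices C))
    many′ C = begin
      length vertices ⊓ r           ≤⟨ many C ⟩
      card (map g vertices)         ≡⟨ cong card (map-cong ρf≡g vertices) ⟨
      card (map (ρ ∘ f) vertices)   ≡⟨ cong card (map-∘ vertices) ⟩
      card (map ρ (map f vertices)) ≤⟨ card-map ρ (map f vertices) ⟩
      card (map f vertices)         ∎
      where
      open ≤-Reasoning
      open Cycle C

  -- Choosability from lists of length j over a palette of order * j colours, which suffices because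
  -- the colours of any list assignment can be renamed injectively into it.
  FinitelyChoosable : ℕ → ℕ → Set
  FinitelyChoosable r j =
    All (λ L → (∀ v → j ≤ card (L v)) → Any (IsAcyclicColoring r G) (Π order L))
        (Π order (λ _ → listsOf j (upTo (order * j))))

  finitelyChoosable? : ∀ r j → Dec (FinitelyChoosable r j)
  finitelyChoosable? r j = All.all?
    (λ L → Fin.all? (λ v → j ≤? card (L v)) →-dec any? (acyclic? r) (Π order L)) _

  choosable⇒finitelyChoosable : ∀ {r j} → IsAcyclicChoosable r G j → FinitelyChoosable r j
  choosable⇒finitelyChoosable choose = All.tabulate λ {L} _ L-card → case choose L L-card of λ
    { (f , f∈ , acyclic) → case Π-complete order L f∈ of λ
      { (g , g∈ , g≡f) → lose g∈ (acyclic-image id g≡f acyclic) } }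

  -- Trimming each list to `j` distinct colours leaves a union `U` with at most `order * j` entries.
  -- A colour is renamed to a position in `U`, and the colouring found from the renamed lists is
  -- pulled back.
  finitelyChoosable⇒choosable : ∀ {r j} → FinitelyChoosable r j → IsAcyclicChoosable r G j
  finitelyChoosable⇒choosable {r} {j} choose L L-card = colour (Π-complete order _ in-palette)
    where
    sub = λ v → sublist-of-card j (L v) (L-card v)
    K : Vertex G → List ℕ
    K v = sub v .proj₁
    K-length : ∀ v → length (K v) ≡ j
    K-length v = sub v .proj₂ .proj₁
    U = concatMap K (allFin order)

    U-length : length U ≤ order * j
    U-length = ≤-trans (length-concatMap-≤ K (allFin order) λ {v} _ → ≤-reflexive (K-length v))
                       (≤-reflexive (cong (_* j) (length-tabulate {n = order} id)))

    ρ : ℕ → ℕ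
    ρ c with c ∈? U
    ... | yes c∈ = toℕ (index c∈)
    -- Colours outside `U` are sent beyond all positions, which keeps `ρ` injective on every colour
    -- and not only on `U`.
    ... | no  _  = length U + c

    ρ-< : ∀ {c} → c ∈ U → ρ c < order * j
    ρ-< {c} c∈ with c ∈? U
    ... | yes c∈′ = ≤-trans (Fin.toℕ<n (index c∈′)) U-length
    ... | no  c∉  = contradiction c∈ c∉

    ρ-injective : ∀ {c d} → ρ c ≡ ρ d → c ≡ d
    ρ-injective {c} {d} eq with c ∈? U | d ∈? U
    ... | yes c∈ | yes d∈ =
      trans (lookup-index c∈) (trans (cong (lookup U) (Fin.toℕ-injective eq)) (sym (lookup-index d∈)))
    ... | yes c∈ | no _   = contradiction (≤-trans (≤-reflexive (cong suc (sym eq))) (Fin.toℕ<n (index c∈))) (m+n≮m _ d)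
    ... | no _   | yes d∈ = contradiction (≤-trans (≤-reflexive (cong suc eq)) (Fin.toℕ<n (index d∈))) (m+n≮m _ c)
    ... | no _   | no _   = +-cancelˡ-≡ (length U) c d eq

    in-palette : ∀ v → map ρ (K v) ∈ listsOf j (upTo (order * j))
    in-palette v = subst (λ ℓ → map ρ (K v) ∈ listsOf ℓ (upTo (order * j)))
                         (trans (length-map ρ (K v)) (K-length v)) (∈-listsOf _ (map ρ (K v)) below)
      where
      below : ∀ {c} → c ∈ map ρ (K v) → c ∈ upTo (order * j)
      below c∈ with ∈-map⁻ ρ c∈
      ... | d , d∈ , refl = ∈-upTo⁺ (ρ-< (∈-concatMap K (∈-allFin v) d∈))

    colour : ∃[ L′ ] L′ ∈ Π order (λ _ → listsOf j (upTo (order * j))) × (∀ v → L′ v ≡ map ρ (K v)) →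
             ∃[ f ] (∀ v → f v ∈ L v) × IsAcyclicColoring r G f
    colour (L′ , L′∈ , L′≡) with find (All.lookup choose L′∈ L′-card)
      where
      L′-card : ∀ v → j ≤ card (L′ v)
      L′-card v rewrite L′≡ v = ≤-trans (≤-reflexive (sym (trans (length-map ρ (K v)) (K-length v))))
        (unique-⊆-card (unique-map⁺ ρ-injective (sub v .proj₂ .proj₂ .proj₁)) id)
    ... | g , g∈ , acyclic = (λ v → preimage v .proj₁) , (λ v → sub v .proj₂ .proj₂ .proj₂ (preimage v .proj₂ .proj₁)) ,
                             acyclic-image ρ (λ v → sym (preimage v .proj₂ .proj₂)) acyclic
      where
      preimage : ∀ v → ∃[ c ] c ∈ K v × g v ≡ ρ c
      preimage v = ∈-map⁻ ρ (subst (g v ∈_) (L′≡ v) (Π-sound order L′ g∈ v))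

  choosable? : ∀ r j → Dec (IsAcyclicChoosable r G j)
  choosable? r j = map′ finitelyChoosable⇒choosable choosable⇒finitelyChoosable (finitelyChoosable? r j)

-- Repeated colours

-- This is the length minus the number of distinct colours, in a recursive form that is visibly
-- monotone under sublists and yields one equation per repeat.
repeats : List ℕ → ℕ
repeats []       = 0
repeats (c ∷ cs) = ι (c ∈? cs) + repeats cs

repeats-⊑ : ∀ {cs ds} → cs ⊑ ds → repeats cs ≤ repeats ds
repeats-⊑ []                               = z≤n
repeats-⊑ (d ∷ʳ cs⊑ds)                     = ≤-trans (repeats-⊑ cs⊑ds) (m≤n+m _ _)
repeats-⊑ {c ∷ cs} {_ ∷ ds} (refl ∷ cs⊑ds) =
  +-mono-≤ (ι-mono (c ∈? cs) (c ∈? ds) (⊑-lookup cs⊑ds)) (repeats-⊑ cs⊑ds)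

repeats-middle : ∀ as c bs → repeats (as ++ c ∷ bs) ≤ ι (c ∈? (as ++ bs)) + repeats (as ++ bs)
repeats-middle []       c bs = ≤-refl
repeats-middle (a ∷ as) c bs = begin
  ι (a ∈? (as ++ c ∷ bs)) + repeats (as ++ c ∷ bs)
    ≤⟨ +-monoʳ-≤ (ι (a ∈? (as ++ c ∷ bs))) (repeats-middle as c bs) ⟩
  ι (a ∈? (as ++ c ∷ bs)) + (ι (c ∈? (as ++ bs)) + repeats (as ++ bs))
    ≡⟨ +-assoc (ι (a ∈? (as ++ c ∷ bs))) _ _ ⟨
  ι (a ∈? (as ++ c ∷ bs)) + ι (c ∈? (as ++ bs)) + repeats (as ++ bs)
    ≤⟨ +-monoˡ-≤ (repeats (as ++ bs)) (exchange (c ≟ a)) ⟩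
  ι (c ∈? (a ∷ as ++ bs)) + ι (a ∈? (as ++ bs)) + repeats (as ++ bs)
    ≡⟨ +-assoc (ι (c ∈? (a ∷ as ++ bs))) _ _ ⟩
  ι (c ∈? (a ∷ as ++ bs)) + (ι (a ∈? (as ++ bs)) + repeats (as ++ bs)) ∎
  where
  open ≤-Reasoning
  to-front : ∀ {x} → x ∈ as ++ c ∷ bs → x ∈ c ∷ as ++ bs
  to-front x∈ with ∈-++⁻ as x∈
  ... | inj₁ x∈as         = there (∈-++⁺ˡ x∈as)
  ... | inj₂ (here x≡c)   = here x≡c
  ... | inj₂ (there x∈bs) = there (∈-++⁺ʳ as x∈bs)
  -- The order in which `a` and `c` are inserted is swapped. If they differ, each indicator is
  -- bounded by its counterpart; if they agree, the first one on the right is already 1.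
  exchange : Dec (c ≡ a) → ι (a ∈? (as ++ c ∷ bs)) + ι (c ∈? (as ++ bs)) ≤ ι (c ∈? (a ∷ as ++ bs)) + ι (a ∈? (as ++ bs))
  exchange (yes refl) = +-monoˡ-≤ (ι (c ∈? (as ++ bs)))
    (≤-trans (ι-≤1 (c ∈? (as ++ c ∷ bs))) (≤-reflexive (sym (ι-yes (c ∈? (c ∷ as ++ bs)) (here refl)))))
  exchange (no c≢a) = ≤-trans (≤-reflexive (+-comm (ι (a ∈? (as ++ c ∷ bs))) _))
    (+-mono-≤ (ι-mono (c ∈? (as ++ bs)) (c ∈? (a ∷ as ++ bs)) there)
              (ι-mono (a ∈? (as ++ c ∷ bs)) (a ∈? (as ++ bs)) λ a∈ → case to-front a∈ of λ
                { (here a≡c) → contradiction (sym a≡c) c≢a ; (there a∈′) → a∈′ }))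

-- Only the last occurrence of each colour is kept: the dropped entries are exactly the counted
-- repeats.
length≤card+repeats : ∀ cs → length cs ≤ card cs + repeats cs
length≤card+repeats cs with last-occurrences cs
  where
  last-occurrences : ∀ cs → ∃[ us ] Unique us × (∀ {x} → x ∈ us → x ∈ cs) × length cs ≡ length us + repeats cs
  last-occurrences [] = [] , [] , id , refl
  last-occurrences (c ∷ cs) with last-occurrences cs | c ∈? cs
  ... | us , u , us⊆ , eq | yes c∈ = us , u , there ∘ us⊆ , trans (cong suc eq) (sym (+-suc _ _))
  ... | us , u , us⊆ , eq | no  c∉ =
    c ∷ us , All.tabulate (λ x∈ → λ { refl → c∉ (us⊆ x∈) }) ∷ u ,
    (λ { (here e) → here e ; (there x∈) → there (us⊆ x∈) }) , cong suc eq
... | us , u , us⊆ , eq = ≤-trans (≤-reflexive eq) (+-monoˡ-≤ (repeats cs) (unique-⊆-card u us⊆))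

Within : ∀ {n} → List (Fin n) → Pairs n → Set
Within xs = All (λ (t , s) → t ∈ xs × s ∈ xs)

-- A repeated entry `x` is equated with a later one. All subsequent equations live among the later
-- entries, where `x` is absent by uniqueness, so the system can be eliminated in list order.
repeats⇒elim : ∀ {n} (f : Fin n → ℕ) j xs → Unique xs → j ≤ repeats (map f xs) →
               ∃[ q ] length q ≡ j × Elim q × Sat f q × Within xs q
repeats⇒elim f zero    xs       _          _  = [] , refl , _ , [] , []
repeats⇒elim f (suc j) (x ∷ xs) (x∉xs ∷ u) j< with f x ∈? map f xs
... | no  _ with repeats⇒elim f (suc j) xs u j<
... | q , len , elim , sat , within = q , len , elim , sat , All.map (λ (t∈ , s∈) → there t∈ , there s∈) within
repeats⇒elim f (suc j) (x ∷ xs) (x∉xs ∷ u) j< | yes fx∈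
  with ∈-map⁻ f fx∈ | repeats⇒elim f j xs u (≤-pred j<)
... | s , s∈ , fx≡fs | q , len , elim , sat , within =
  (x , s) ∷ q , cong suc len ,
  ((λ { refl → x∉ s∈ }) ,
   All.map (λ (t∈ , s∈) → (λ { refl → x∉ t∈ }) , (λ { refl → x∉ s∈ })) within ,
   elim) ,
  fx≡fs ∷ sat ,
  (here refl , there s∈) ∷ All.map (λ (t∈ , s∈) → there t∈ , there s∈) within
  where
  x∉ : ¬ x ∈ xs
  x∉ x∈ = All.lookup x∉xs x∈ refl

unique-middle : ∀ {A : Set} {x : A} as bs → Unique (as ++ x ∷ bs) → Unique (x ∷ as ++ bs)
unique-middle {A} {x} as bs = Unique-resp-↭ (setoid A) (↭⇒↭ₛ (shift x as bs))

-- Without `v` there are at most `j` repeats, and inserting `v` adds at most one, only if its colour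
-- occurs elsewhere. So `v` shares a colour with some `s`, and the `j` other equations can be drawn
-- from the list without `v`; this puts the equation at `v` first.
new-repeat : ∀ {n} (f : Fin n → ℕ) X v j xs → Unique xs →
             suc j ≤ repeats (map f (filter (_∈ₛ? X) xs)) →
             repeats (map f (filter (_∈ₛ? (X - v)) xs)) ≤ j →
             v ∈ xs × ∃[ s ] ∃[ q ] length q ≡ j × s ∈ xs × Within xs q ×
               Elim ((v , s) ∷ q) × Sat f ((v , s) ∷ q)
new-repeat {n} f X v j xs u-xs j< ≤j = conclude (v ∈ᶠ? ys)
  where
  open import Data.List.Membership.DecPropositional (Fin._≟_ {n}) using () renaming (_∈?_ to _∈ᶠ?_)
  ys = filter (_∈ₛ? X) xs

  few-without-v : ∀ zs → zs ⊑ ys → (∀ {x} → x ∈ zs → x ≢ v) → repeats (map f zs) ≤ j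
  few-without-v zs zs⊑ys ≢v = ≤-trans (repeats-⊑ (⊑-map⁺ f zs⊑survivors)) ≤j
    where
    in-X : ∀ {x} → x ∈ zs → x ∈ₛ X
    in-X x∈zs = ∈-filter⁻ (_∈ₛ? X) {xs = xs} (⊑-lookup zs⊑ys x∈zs) .proj₂
    zs⊑survivors : zs ⊑ filter (_∈ₛ? (X - v)) xs
    zs⊑survivors = subst (_⊑ filter (_∈ₛ? (X - v)) xs)
      (filter-all (_∈ₛ? (X - v)) (All.tabulate λ x∈ → x∈p∧x≢y⇒x∈p-y (in-X x∈) (≢v x∈)))
      (⊆-filter-Sublist (_∈ₛ? (X - v)) (_∈ₛ? (X - v)) (λ { refl → id }) (⊑-trans zs⊑ys (filter-⊑ (_∈ₛ? X) xs)))

  conclude : Dec (v ∈ ys) → _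
  conclude (no v∉ys) = contradiction (≤-trans j< (few-without-v ys ⊑-refl λ { x∈ refl → v∉ys x∈ })) 1+n≰n
  conclude (yes v∈ys) with ∈-∃++ v∈ys
  ... | as , bs , ys≡ = found (f v ∈? map f zs)
    where
    zs = as ++ bs
    v∷zs-unique : Unique (v ∷ zs)
    v∷zs-unique = unique-middle as bs (subst Unique ys≡ (unique-filter⁺ (_∈ₛ? X) u-xs))
    zs⊆xs : ∀ {x} → x ∈ zs → x ∈ xs
    zs⊆xs x∈zs = ∈-filter⁻ (_∈ₛ? X) {xs = xs} (subst (_ ∈_) (sym ys≡) (case ∈-++⁻ as x∈zs of λ
      { (inj₁ x∈as) → ∈-++⁺ˡ x∈as ; (inj₂ x∈bs) → ∈-++⁺ʳ as (there x∈bs) })) .proj₁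
    v∉zs : ¬ v ∈ zs
    v∉zs v∈ with v∷zs-unique
    ... | v≢ ∷ _ = All.lookup v≢ v∈ refl
    few : repeats (map f zs) ≤ j
    few = few-without-v zs (subst (zs ⊑_) (sym ys≡) (⊑-++⁺ (⊑-refl {x = as}) (v ∷ʳ ⊑-refl))) λ { x∈ refl → v∉zs x∈ }
    split : suc j ≤ ι (f v ∈? map f zs) + repeats (map f zs)
    split = begin
      suc j                                               ≤⟨ j< ⟩
      repeats (map f ys)                                  ≡⟨ cong (repeats ∘ map f) ys≡ ⟩
      repeats (map f (as ++ v ∷ bs))                      ≡⟨ cong repeats (map-++ f as (v ∷ bs)) ⟩
      repeats (map f as ++ f v ∷ map f bs)                ≤⟨ repeats-middle (map f as) (f v) (map f bs) ⟩
      ι (f v ∈? (map f as ++ map f bs)) + repeats (map f as ++ map f bs)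
        ≡⟨ cong (λ cs → ι (f v ∈? cs) + repeats cs) (map-++ f as bs) ⟨
      ι (f v ∈? map f zs) + repeats (map f zs) ∎
      where open ≤-Reasoning

    found : (d : Dec (f v ∈ map f zs)) → _
    found (no fv∉) = contradiction (≤-trans split (+-mono-≤ (≤-reflexive (ι-no fv∉)) few)) 1+n≰n
      where
      ι-no : ∀ {P : Set} {d : Dec P} → ¬ P → ι d ≡ 0
      ι-no {d = yes p} ¬p = contradiction p ¬p
      ι-no {d = no _}  _  = refl
    found (yes fv∈)
      with ∈-map⁻ f fv∈ | repeats⇒elim f j zs (unique-tail v∷zs-unique)
                            (≤-pred (≤-trans split (+-monoˡ-≤ (repeats (map f zs)) (ι-≤1 (f v ∈? map f zs)))))
      where
      unique-tail : ∀ {A : Set} {x : A} {xs} → Unique (x ∷ xs) → Unique xs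
      unique-tail (_ ∷ u) = u
    ... | s , s∈ , fv≡fs | q , len , elim , sat , within =
      v∈xs , s , q , len , zs⊆xs s∈ , All.map (λ (t∈ , s∈) → zs⊆xs t∈ , zs⊆xs s∈) within ,
      ((λ { refl → v∉zs s∈ }) ,
       All.map (λ (t∈ , s∈) → (λ { refl → v∉zs t∈ }) , (λ { refl → v∉zs s∈ })) within ,
       elim) ,
      fv≡fs ∷ sat
      where
      v∈xs : v ∈ xs
      v∈xs = ∈-filter⁻ (_∈ₛ? X) {xs = xs} v∈ys .proj₁

-- Averaging and lists of fixed length

∑-filter : ∀ {A : Set} {P : A → Set} (P? : Decidable P) xs (g : A → ℕ) →
           ∑ (filter P? xs) g ≡ ∑ xs (λ x → ι (P? x) * g x)
∑-filter P? []       g = refl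
∑-filter P? (x ∷ xs) g with P? x
... | yes _ = cong₂ _+_ (sym (*-identityˡ (g x))) (∑-filter P? xs g)
... | no  _ = ∑-filter P? xs g

∑-ι : ∀ {A : Set} {P : A → Set} (P? : Decidable P) xs → ∑ xs (λ x → ι (P? x)) ≡ length (filter P? xs)
∑-ι P? []       = refl
∑-ι P? (x ∷ xs) with P? x
... | yes _ = cong suc (∑-ι P? xs)
... | no  _ = ∑-ι P? xs

-- The threshold is T / b, cleared of the division.
markov : ∀ {A : Set} (xs : List A) (g : A → ℕ) T b .{{_ : NonZero T}} → ∑ xs g ≤ T →
         length (filter (λ x → T <? g x * b) xs) ≤ b
markov xs g T b ∑≤T = *-cancelʳ-≤ _ b T (begin
  length big * T                           ≡⟨ ∑-const big T ⟨
  ∑ big (λ _ → T)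
    ≤⟨ ∑-mono big (λ x∈ → <⇒≤ (∈-filter⁻ (λ x → T <? g x * b) {xs = xs} x∈ .proj₂)) ⟩
  ∑ big (λ x → g x * b)                    ≡⟨ ∑-filter (λ x → T <? g x * b) xs (λ x → g x * b) ⟩
  ∑ xs (λ x → ι (T <? g x * b) * (g x * b))
    ≤⟨ ∑-mono xs (λ {x} _ → ≤-trans (*-monoˡ-≤ (g x * b) (ι-≤1 (T <? g x * b))) (≤-reflexive (*-identityˡ _))) ⟩
  ∑ xs (λ x → g x * b)                     ≡⟨ ∑-*ʳ b xs g ⟩
  ∑ xs g * b                               ≤⟨ *-monoˡ-≤ b ∑≤T ⟩
  T * b                                    ≡⟨ *-comm T b ⟩
  b * T                                    ∎)
  where
  open ≤-Reasoning
  big = filter (λ x → T <? g x * b) xs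

length-listsOf : ∀ {A : Set} ℓ (xs : List A) → length (listsOf ℓ xs) ≤ length xs ^ ℓ
length-listsOf zero    xs = ≤-refl
length-listsOf (suc ℓ) xs = length-concatMap-≤ _ xs λ {x} _ →
  ≤-trans (≤-reflexive (length-map (x ∷_) (listsOf ℓ xs))) (length-listsOf ℓ xs)

listsOf-length : ∀ {A : Set} ℓ (xs : List A) {ys} → ys ∈ listsOf ℓ xs → length ys ≡ ℓ
listsOf-length zero    xs (here refl) = refl
listsOf-length (suc ℓ) xs ys∈ with concatMap-∈ _ xs ys∈
... | x , _ , ys∈′ with ∈-map⁻ (x ∷_) ys∈′
... | zs , zs∈ , refl = cong suc (listsOf-length ℓ xs zs∈)

linked-++ˡ : ∀ {A : Set} {R : A → A → Set} xs {ys} → Linked R (xs ++ ys) → Linked R xs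
linked-++ˡ []           _        = []
linked-++ˡ (x ∷ [])     _        = [-]
linked-++ˡ (x ∷ y ∷ xs) (xy ∷ l) = xy ∷ linked-++ˡ (y ∷ xs) l

-- Walks

module Walks (G : Graph) where
  open Graph G using (order; Adj; adj?; adj-sym; adj-irrefl; degree)
  private
    V = Vertex G
    Δ = maxDegree G
    vs = allFin order

  nbrs : V → List V
  nbrs v = filter (adj? v) vs

  ∈-nbrs : ∀ {u v} → Adj u v → v ∈ nbrs u
  ∈-nbrs {u} {v} uv = ∈-filter⁺ (adj? u) (∈-allFin v) uv

  nbrs-adj : ∀ {u v} → v ∈ nbrs u → Adj u v
  nbrs-adj {u} v∈ = ∈-filter⁻ (adj? u) {xs = vs} v∈ .proj₂

  nbrs-≤ : ∀ v → length (nbrs v) ≤ Δ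
  nbrs-≤ v = All.lookup (xs≤max 0 (map degree vs)) (∈-map⁺ degree (∈-allFin v))

  data Walk : ℕ → V → V → List V → Set where
    stop : ∀ {u} → Walk 0 u u [ u ]
    step : ∀ {ℓ u x w xs} → Adj u x → Walk ℓ x w xs → Walk (suc ℓ) u w (u ∷ xs)

  walk-++ : ∀ {k ℓ u x w xs ys} → Walk k u x xs → Walk ℓ x w ys →
            ∃[ zs ] Walk (k + ℓ) u w zs × (∀ {z} → z ∈ xs ++ ys → z ∈ zs)
  walk-++ {ys = ys} stop q = ys , q , λ { (here refl) → start∈ q ; (there z∈) → z∈ }
    where
    start∈ : ∀ {ℓ u w xs} → Walk ℓ u w xs → u ∈ xs
    start∈ stop       = here refl
    start∈ (step _ _) = here refl
  walk-++ (step ux p) q with walk-++ p q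
  ... | zs , r , ⊆zs = _ ∷ zs , step ux r , λ { (here refl) → here refl ; (there z∈) → there (⊆zs z∈) }

  walk-reverse : ∀ {ℓ u w xs} → Walk ℓ u w xs → ∃[ ys ] Walk ℓ w u ys
  walk-reverse stop = _ , stop
  walk-reverse {suc ℓ} {u} {w} (step ux p) with walk-++ (walk-reverse p .proj₂) (step (adj-sym ux) stop)
  ... | zs , r , _ = zs , subst (λ k → Walk k w u zs) (+-comm ℓ 1) r

  walk-split : ∀ {ℓ u w zs z} → Walk ℓ u w zs → z ∈ zs →
               ∃[ a ] ∃[ b ] ∃[ xs ] ∃[ ys ]
                 a + b ≡ ℓ × Walk a u z xs × Walk b z w ys × (∀ {y} → y ∈ zs → y ∈ xs ++ ys)
  walk-split stop          (here refl) = 0 , 0 , _ , _ , refl , stop , stop , there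
  walk-split (step ux p)   (here refl) = 0 , _ , _ , _ , refl , stop , step ux p , there
  walk-split (step ux p)   (there z∈) with walk-split p z∈
  ... | a , b , xs , ys , a+b≡ , q , r , ⊆ =
    suc a , b , _ , _ , cong suc a+b≡ , step ux q , r , λ { (here refl) → here refl ; (there y∈) → there (⊆ y∈) }

  linked⇒walk : ∀ x xs {w} → Linked Adj ((x ∷ xs) ++ w ∷ []) → Walk (suc (length xs)) x w ((x ∷ xs) ++ w ∷ [])
  linked⇒walk x []       (xw ∷ _) = step xw stop
  linked⇒walk x (y ∷ xs) (xy ∷ l) = step xy (linked⇒walk y xs l)

  -- The closed walk is cut at `u`, its two pieces are rejoined in the other order at `start`, and
  -- the resulting closed walk from `u` is cut at `w`.
  arcs : ∀ (C : Cycle G) {u w} → let open Cycle C in u ∈ vertices → w ∈ vertices →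
         ∃[ a ] ∃[ b ] ∃[ xs ] ∃[ ys ]
           a + b ≡ length vertices × Walk a u w xs × Walk b w u ys × (∀ {z} → z ∈ vertices → z ∈ xs ++ ys)
  arcs C {u} {w} u∈ w∈ with walk-split (linked⇒walk start rest closed) (∈-++⁺ˡ u∈)
    where open Cycle C
  ... | a , b , xs , ys , a+b≡ , p , q , ⊆ with walk-++ q p
  ... | zs , r , ⊆zs with walk-split r (⊆zs′ (⊆ (∈-++⁺ˡ w∈)))
    where
    ⊆zs′ : ∀ {z} → z ∈ xs ++ ys → z ∈ zs
    ⊆zs′ z∈ = ⊆zs (case ∈-++⁻ xs z∈ of λ { (inj₁ z∈xs) → ∈-++⁺ʳ ys z∈xs ; (inj₂ z∈ys) → ∈-++⁺ˡ z∈ys })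
  ... | a′ , b′ , xs′ , ys′ , a′+b′≡ , p′ , q′ , ⊆′ =
    a′ , b′ , xs′ , ys′ , trans a′+b′≡ (trans (+-comm b a) a+b≡) , p′ , q′ ,
    λ z∈ → ⊆′ (⊆zs (case ∈-++⁻ xs (⊆ (∈-++⁺ˡ z∈)) of λ { (inj₁ z∈xs) → ∈-++⁺ʳ ys z∈xs ; (inj₂ z∈ys) → ∈-++⁺ˡ z∈ys }))

  -- Endpoints of the walks of length 1, …, j from x whose first step avoids v and which never turn back.
  beyond : ℕ → V → V → List V
  beyond zero    x v = []
  beyond (suc j) x v = concatMap (λ y → y ∷ beyond j y x) (filter (λ y → ¬? (y Fin.≟ v)) (nbrs x))

  near : ℕ → V → List V
  near zero    v = []
  near (suc j) v = concatMap (λ x → x ∷ beyond j x v) (nbrs v)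

  beyond-walk : ∀ j x v {w} → w ∈ beyond j x v → ∃[ ℓ ] ∃[ xs ] ℓ ≤ j × Walk ℓ x w xs
  beyond-walk (suc j) x v w∈ with concatMap-∈ _ _ w∈
  ... | y , y∈ , w∈′ with ∈-filter⁻ (λ y → ¬? (y Fin.≟ v)) {xs = nbrs x} y∈ | w∈′
  ... | y∈nbrs , _ | here refl = 1 , _ , s≤s z≤n , step (nbrs-adj y∈nbrs) stop
  ... | y∈nbrs , _ | there w∈″ with beyond-walk j y x w∈″
  ... | ℓ , xs , ℓ≤j , p = suc ℓ , _ , s≤s ℓ≤j , step (nbrs-adj y∈nbrs) p

  near-walk : ∀ j v {w} → w ∈ near j v → ∃[ ℓ ] ∃[ xs ] ℓ ≤ j × Walk ℓ v w xs
  near-walk (suc j) v w∈ with concatMap-∈ _ (nbrs v) w∈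
  ... | x , x∈ , here refl = 1 , _ , s≤s z≤n , step (nbrs-adj x∈) stop
  ... | x , x∈ , there w∈′ with beyond-walk j x v w∈′
  ... | ℓ , xs , ℓ≤j , p = suc ℓ , _ , s≤s ℓ≤j , step (nbrs-adj x∈) p

  -- A walk that returns to v is cut down to a shorter walk starting at v.
  walk-beyond : ∀ ℓ j x v w {xs} → Adj v x → Walk ℓ x w xs → ℓ ≤ j →
                w ∈ x ∷ beyond j x v ⊎ (∃[ k ] ∃[ ys ] k < ℓ × Walk k v w ys)
  walk-beyond = <-rec Claim go
    where
    Claim : ℕ → Set
    Claim ℓ = ∀ j x v w {xs} → Adj v x → Walk ℓ x w xs → ℓ ≤ j →
              w ∈ x ∷ beyond j x v ⊎ (∃[ k ] ∃[ ys ] k < ℓ × Walk k v w ys)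
    go : ∀ ℓ → (∀ {k} → k < ℓ → Claim k) → Claim ℓ
    go zero    rec j       x v w vx stop          _         = inj₁ (here refl)
    go (suc ℓ) rec (suc j) x v w vx (step {x = y} xy p) (s≤s ℓ≤j) with y Fin.≟ v
    ... | yes refl = inj₂ (ℓ , _ , ≤-refl , p)
    ... | no y≢v with rec ≤-refl j y x w xy p ℓ≤j
    ... | inj₁ w∈ = inj₁ (there (∈-concatMap _ (∈-filter⁺ (λ y → ¬? (y Fin.≟ v)) (∈-nbrs xy) y≢v) w∈))
    -- The remaining walk came back to `x`. The detour is cut out and the shorter walk `q` from `x`
    -- is treated afresh with the full budget.
    ... | inj₂ (k , ys , k<ℓ , q) with rec {k} (m<n⇒m<1+n k<ℓ) (suc j) x v w vx q (m≤n⇒m≤1+n (≤-trans (<⇒≤ k<ℓ) ℓ≤j))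
    ... | inj₁ w∈ = inj₁ w∈
    ... | inj₂ (k′ , zs , k′<k , r) = inj₂ (k′ , zs , <-trans k′<k (m<n⇒m<1+n k<ℓ) , r)

  walk⇒near : ∀ ℓ j v w {xs} → Walk ℓ v w xs → ℓ ≤ j → v ≢ w → w ∈ near j v
  walk⇒near = <-rec Claim go
    where
    Claim : ℕ → Set
    Claim ℓ = ∀ j v w {xs} → Walk ℓ v w xs → ℓ ≤ j → v ≢ w → w ∈ near j v
    go : ∀ ℓ → (∀ {k} → k < ℓ → Claim k) → Claim ℓ
    go zero    rec j       v w stop                _         v≢w = contradiction refl v≢w
    go (suc ℓ) rec (suc j) v w (step {x = x} vx p) (s≤s ℓ≤j) v≢w with walk-beyond ℓ j x v w vx p ℓ≤j
    ... | inj₁ w∈ = ∈-concatMap _ (∈-nbrs vx) w∈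
    ... | inj₂ (k , ys , k<ℓ , q) =
      rec {k} (m<n⇒m<1+n k<ℓ) (suc j) v w q (m≤n⇒m≤1+n (≤-trans (<⇒≤ k<ℓ) ℓ≤j)) v≢w

  near-sym : ∀ j {v w} → v ≢ w → w ∈ near j v → v ∈ near j w
  near-sym j {v} {w} v≢w w∈ with near-walk j v w∈
  ... | ℓ , xs , ℓ≤j , p = walk⇒near ℓ j w v (walk-reverse p .proj₂) ℓ≤j (v≢w ∘ sym)

  module Counts (1≤Δ : 1 ≤ Δ) where

    Δ^-positive : ∀ j → 1 ≤ Δ ^ j
    Δ^-positive zero    = ≤-refl
    Δ^-positive (suc j) = *-mono-≤ 1≤Δ (Δ^-positive j)

    beyond-≤ : ∀ j x v → Adj x v → suc (length (beyond j x v)) ≤ Δ ^ j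
    beyond-≤ zero    x v xv = ≤-refl
    beyond-≤ (suc j) x v xv = begin
      suc (length (beyond (suc j) x v))
        ≤⟨ +-mono-≤ (Δ^-positive j) (length-concatMap-≤ _ others λ {y} y∈ → beyond-≤ j y x (adj-sym
             (nbrs-adj (∈-filter⁻ (λ y → ¬? (y Fin.≟ v)) {xs = nbrs x} y∈ .proj₁)))) ⟩
      suc (length others) * Δ ^ j
        ≤⟨ *-monoˡ-≤ (Δ ^ j) (≤-trans (filter-notAll _ (nbrs x) (lose (∈-nbrs xv) (λ v≢v → v≢v refl))) (nbrs-≤ x)) ⟩
      Δ * Δ ^ j ∎
      where
      open ≤-Reasoning
      others = filter (λ y → ¬? (y Fin.≟ v)) (nbrs x)

    -- Because no walk turns back, all lengths up to `j` fit into a single power. This gives the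
    -- main term of the theorem the coefficient 1; bounding each length separately would leave a sum
    -- of powers.
    near-≤ : ∀ j v → length (near j v) ≤ Δ ^ j
    near-≤ zero    v = z≤n
    near-≤ (suc j) v = ≤-trans
      (length-concatMap-≤ _ (nbrs v) λ {x} x∈ → beyond-≤ j x v (adj-sym (nbrs-adj x∈)))
      (*-monoˡ-≤ (Δ ^ j) (nbrs-≤ v))

  walks : ℕ → V → V → List (List V)
  walks zero    u w = map (λ _ → [ u ]) (filter (Fin._≟ w) [ u ])
  walks (suc ℓ) u w = concatMap (λ x → map (u ∷_) (walks ℓ x w)) (nbrs u)

  #walks : ℕ → V → V → ℕ
  #walks ℓ u w = length (walks ℓ u w)

  walk∈walks : ∀ {ℓ u w xs} → Walk ℓ u w xs → xs ∈ walks ℓ u w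
  walk∈walks {u = u} stop = ∈-map⁺ (λ _ → [ u ]) (∈-filter⁺ (Fin._≟ u) {xs = [ u ]} (here refl) refl)
  walk∈walks (step ux p)  = ∈-concatMap _ (∈-nbrs ux) (∈-map⁺ _ (walk∈walks p))

  walks-length : ∀ ℓ u w {xs} → xs ∈ walks ℓ u w → length xs ≡ suc ℓ
  walks-length zero    u w xs∈ with ∈-map⁻ _ xs∈
  ... | _ , _ , refl = refl
  walks-length (suc ℓ) u w xs∈ with concatMap-∈ _ (nbrs u) xs∈
  ... | x , _ , xs∈′ with ∈-map⁻ (u ∷_) xs∈′
  ... | ys , ys∈ , refl = cong suc (walks-length ℓ x w ys∈)

  #walks-zero : ∀ u w → #walks 0 u w ≡ ι (u Fin.≟ w)
  #walks-zero u w with u Fin.≟ w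
  ... | yes _ = refl
  ... | no  _ = refl

  #walks-suc : ∀ ℓ u w → #walks (suc ℓ) u w ≡ ∑ (nbrs u) (λ x → #walks ℓ x w)
  #walks-suc ℓ u w = trans (length-concatMap _ (nbrs u)) (∑-cong (nbrs u) λ x → length-map (u ∷_) (walks ℓ x w))

  ∑-#walks-from : ∀ ℓ u → ∑ vs (#walks ℓ u) ≤ Δ ^ ℓ
  ∑-#walks-from zero    u = ≤-trans
    (≤-reflexive (∑-cong vs λ w → trans (#walks-zero u w) (ι-cong (u Fin.≟ w) (w Fin.≟ u) sym sym)))
    (∑-ι-≡ Fin._≟_ vs (allFin⁺ order))
  ∑-#walks-from (suc ℓ) u = begin
    ∑ vs (#walks (suc ℓ) u)                      ≡⟨ ∑-cong vs (#walks-suc ℓ u) ⟩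
    ∑ vs (λ w → ∑ (nbrs u) (λ x → #walks ℓ x w))    ≡⟨ ∑-comm (nbrs u) vs (#walks ℓ) ⟨
    ∑ (nbrs u) (λ x → ∑ vs (#walks ℓ x))            ≤⟨ ∑-≤ (nbrs u) (λ {x} _ → ∑-#walks-from ℓ x) ⟩
    length (nbrs u) * Δ ^ ℓ                         ≤⟨ *-monoˡ-≤ (Δ ^ ℓ) (nbrs-≤ u) ⟩
    Δ * Δ ^ ℓ                                    ∎
    where open ≤-Reasoning

  -- The sums over the start and the first step are exchanged, and the in-degree is the degree by
  -- symmetry. This avoids a bijection between walks and their reversals.
  ∑-#walks-to : ∀ ℓ w → ∑ vs (λ u → #walks ℓ u w) ≤ Δ ^ ℓ
  ∑-#walks-to zero    w = ≤-trans (≤-reflexive (∑-cong vs λ u → #walks-zero u w)) (∑-ι-≡ Fin._≟_ vs (allFin⁺ order))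
  ∑-#walks-to (suc ℓ) w = begin
    ∑ vs (λ u → #walks (suc ℓ) u w)
      ≡⟨ ∑-cong vs (λ u → trans (#walks-suc ℓ u w) (∑-filter (adj? u) vs (λ x → #walks ℓ x w))) ⟩
    ∑ vs (λ u → ∑ vs (λ x → ι (adj? u x) * #walks ℓ x w))
      ≡⟨ ∑-comm vs vs (λ u x → ι (adj? u x) * #walks ℓ x w) ⟩
    ∑ vs (λ x → ∑ vs (λ u → ι (adj? u x) * #walks ℓ x w))
      ≡⟨ ∑-cong vs (λ x → ∑-*ʳ (#walks ℓ x w) vs (λ u → ι (adj? u x))) ⟩
    ∑ vs (λ x → ∑ vs (λ u → ι (adj? u x)) * #walks ℓ x w)
      ≤⟨ ∑-mono vs (λ {x} _ → *-monoˡ-≤ (#walks ℓ x w) (indegree x)) ⟩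
    ∑ vs (λ x → Δ * #walks ℓ x w)
      ≡⟨ ∑-*ˡ Δ vs (λ x → #walks ℓ x w) ⟩
    Δ * ∑ vs (λ x → #walks ℓ x w)
      ≤⟨ *-monoʳ-≤ Δ (∑-#walks-to ℓ w) ⟩
    Δ * Δ ^ ℓ ∎
    where
    open ≤-Reasoning
    indegree : ∀ x → ∑ vs (λ u → ι (adj? u x)) ≤ Δ
    indegree x = ≤-trans
      (≤-reflexive (trans (∑-cong vs λ u → ι-cong (adj? u x) (adj? x u) adj-sym adj-sym) (∑-ι (adj? x) vs)))
      (nbrs-≤ x)

  walksFrom : ℕ → V → List (List V)
  walksFrom zero    v = [ [ v ] ]
  walksFrom (suc ℓ) v = concatMap (λ x → map (v ∷_) (walksFrom ℓ x)) (nbrs v)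

  extend : List V → List (List V)
  extend []       = []
  extend (x ∷ xs) = map (_∷ x ∷ xs) (nbrs x)

  -- Walks of length i + ℓ with v in position i.
  through : ℕ → ℕ → V → List (List V)
  through zero    ℓ v = walksFrom ℓ v
  through (suc i) ℓ v = concatMap extend (through i ℓ v)

  walksFrom-≤ : ∀ ℓ v → length (walksFrom ℓ v) ≤ Δ ^ ℓ
  walksFrom-≤ zero    v = ≤-refl
  walksFrom-≤ (suc ℓ) v = ≤-trans
    (length-concatMap-≤ _ (nbrs v) λ {x} _ → ≤-trans (≤-reflexive (length-map (v ∷_) (walksFrom ℓ x))) (walksFrom-≤ ℓ x))
    (*-monoˡ-≤ (Δ ^ ℓ) (nbrs-≤ v))

  through-≤ : ∀ i ℓ v → length (through i ℓ v) ≤ Δ ^ (i + ℓ)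
  through-≤ zero    ℓ v = walksFrom-≤ ℓ v
  through-≤ (suc i) ℓ v = ≤-trans
    (length-concatMap-≤ extend (through i ℓ v) λ {xs} _ → extend-≤ xs)
    (≤-trans (*-monoˡ-≤ Δ (through-≤ i ℓ v)) (≤-reflexive (*-comm (Δ ^ (i + ℓ)) Δ)))
    where
    extend-≤ : ∀ xs → length (extend xs) ≤ Δ
    extend-≤ []       = z≤n
    extend-≤ (x ∷ xs) = ≤-trans (≤-reflexive (length-map _ (nbrs x))) (nbrs-≤ x)

  walksFrom-length : ∀ ℓ v {xs} → xs ∈ walksFrom ℓ v → length xs ≡ suc ℓ
  walksFrom-length zero    v (here refl) = refl
  walksFrom-length (suc ℓ) v xs∈ with concatMap-∈ _ (nbrs v) xs∈
  ... | x , _ , xs∈′ with ∈-map⁻ (v ∷_) xs∈′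
  ... | ys , ys∈ , refl = cong suc (walksFrom-length ℓ x ys∈)

  through-length : ∀ i ℓ v {xs} → xs ∈ through i ℓ v → length xs ≡ suc (i + ℓ)
  through-length zero    ℓ v xs∈ = walksFrom-length ℓ v xs∈
  through-length (suc i) ℓ v xs∈ with concatMap-∈ extend (through i ℓ v) xs∈
  ... | x ∷ ys , ys∈ , xs∈′ with ∈-map⁻ (_∷ x ∷ ys) xs∈′
  ... | _ , _ , refl = cong suc (through-length i ℓ v ys∈)

  linked∈walksFrom : ∀ v xs → Linked Adj (v ∷ xs) → v ∷ xs ∈ walksFrom (length xs) v
  linked∈walksFrom v []       _        = here refl
  linked∈walksFrom v (x ∷ xs) (vx ∷ l) = ∈-concatMap _ (∈-nbrs vx) (∈-map⁺ (v ∷_) (linked∈walksFrom x xs l))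

  linked∈through : ∀ as v bs → Linked Adj (as ++ v ∷ bs) → as ++ v ∷ bs ∈ through (length as) (length bs) v
  linked∈through []            v bs l        = linked∈walksFrom v bs l
  linked∈through (a ∷ [])      v bs (av ∷ l) =
    ∈-concatMap extend (linked∈through [] v bs l) (∈-map⁺ (_∷ v ∷ bs) (∈-nbrs (adj-sym av)))
  linked∈through (a ∷ a′ ∷ as) v bs (aa′ ∷ l) =
    ∈-concatMap extend (linked∈through (a′ ∷ as) v bs l) (∈-map⁺ (_∷ a′ ∷ as ++ v ∷ bs) (∈-nbrs (adj-sym aa′)))

-- Counting pairs and halving cycles

∑-filter-≤ : ∀ {A : Set} {P : A → Set} (P? : Decidable P) xs (g : A → ℕ) → ∑ (filter P? xs) g ≤ ∑ xs g
∑-filter-≤ P? xs g = ≤-trans (≤-reflexive (∑-filter P? xs g))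
  (∑-mono xs λ {x} _ → ≤-trans (*-monoˡ-≤ (g x) (ι-≤1 (P? x))) (≤-reflexive (*-identityˡ _)))

length-cartesianProduct : ∀ {A B : Set} (xs : List A) (ys : List B) →
                          length (cartesianProduct xs ys) ≡ length xs * length ys
length-cartesianProduct []       ys = refl
length-cartesianProduct (x ∷ xs) ys =
  trans (length-++ (map (x ,_) ys)) (cong₂ _+_ (length-map (x ,_) ys) (length-cartesianProduct xs ys))

pairs : ∀ {n} → ℕ → List (Fin n) → List (Pairs n)
pairs j zs = listsOf j (cartesianProduct zs zs)

within⇒∈pairs : ∀ {n j zs} {q : Pairs n} → length q ≡ j → Within zs q → q ∈ pairs j zs
within⇒∈pairs {zs = zs} {q} refl within =
  ∈-listsOf _ q λ ts∈ → let t∈ , s∈ = All.lookup within ts∈ in ∈-cartesianProduct⁺ t∈ s∈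

within-⊆ : ∀ {n xs ys} {q : Pairs n} → (∀ {x} → x ∈ xs → x ∈ ys) → Within xs q → Within ys q
within-⊆ xs⊆ys = All.map λ (t∈ , s∈) → xs⊆ys t∈ , xs⊆ys s∈

length-pairs : ∀ {n} j (zs : List (Fin n)) {ℓ} → length zs ≤ ℓ → length (pairs j zs) ≤ (ℓ * ℓ) ^ j
length-pairs j zs zs≤ℓ = ≤-trans (length-listsOf j (cartesianProduct zs zs))
  (^-monoˡ-≤ j (≤-trans (≤-reflexive (length-cartesianProduct zs zs)) (*-mono-≤ zs≤ℓ zs≤ℓ)))

^-monus : ∀ D i r → i < 2 + r → D ^ (i + (suc r ∸ i)) ≡ D ^ suc r
^-monus D i r (s≤s i≤1+r) = cong (D ^_) (m+[n∸m]≡n i≤1+r)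

⌈n/2⌉≤1+⌊n/2⌋ : ∀ n → ⌈ n /2⌉ ≤ suc ⌊ n /2⌋
⌈n/2⌉≤1+⌊n/2⌋ n = ⌊n/2⌋-mono (n≤1+n (suc n))

-- If both arcs exceed ⌊r/2⌋, then ⌊r/2⌋ + 1 + ⌈r/2⌉ = r + 1 leaves at most ⌈r/2⌉ for each, so both
-- are exactly half of r + 1. This happens only for odd r.
short-arc : ∀ r a b → a + b ≤ suc r → a ≤ ⌊ r /2⌋ ⊎ b ≤ ⌊ r /2⌋ ⊎ (a ≡ ⌈ r /2⌉ × b ≡ ⌈ r /2⌉ × a + b ≡ suc r)
short-arc r a b a+b≤ with a ≤? ⌊ r /2⌋ | b ≤? ⌊ r /2⌋
... | yes a≤ | _      = inj₁ a≤
... | no  _  | yes b≤ = inj₂ (inj₁ b≤)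
... | no a≰  | no b≰  = inj₂ (inj₂ (a≡ , b≡ ,
  ≤-antisym a+b≤ (≤-trans (≤-reflexive (sym sum≡)) (+-mono-≤ (≰⇒> a≰) (≤-reflexive (sym b≡))))))
  where
  sum≡ : suc ⌊ r /2⌋ + ⌈ r /2⌉ ≡ suc r
  sum≡ = cong suc (⌊n/2⌋+⌈n/2⌉≡n r)
  bound : ∀ a b → a + b ≤ suc r → ⌊ r /2⌋ < b → a ≤ ⌈ r /2⌉
  bound a b a+b≤ h<b = +-cancelˡ-≤ (suc ⌊ r /2⌋) a ⌈ r /2⌉ (begin
    suc ⌊ r /2⌋ + a       ≤⟨ +-monoˡ-≤ a h<b ⟩
    b + a                 ≡⟨ +-comm b a ⟩
    a + b                 ≤⟨ a+b≤ ⟩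
    suc r                 ≡⟨ sum≡ ⟨
    suc ⌊ r /2⌋ + ⌈ r /2⌉ ∎)
    where open ≤-Reasoning
  a≡ : a ≡ ⌈ r /2⌉
  a≡ = ≤-antisym (bound a b a+b≤ (≰⇒> b≰)) (≤-trans (⌈n/2⌉≤1+⌊n/2⌋ r) (≰⇒> a≰))
  b≡ : b ≡ ⌈ r /2⌉
  b≡ = ≤-antisym (bound b a (≤-trans (≤-reflexive (+-comm b a)) a+b≤) (≰⇒> a≰)) (≤-trans (⌈n/2⌉≤1+⌊n/2⌋ r) (≰⇒> b≰))

-- Conflicts in a graph

-- `K₁` bounds the choices of one pair from two joined half-walks, which have 2(⌈r/2⌉ + 1) ≤ r + 3
-- entries because both ends are listed twice. `K₂` multiplies the positions of `v` on a path, the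
-- choices of its partner, and the choices of two pairs.
K₁ K₂ : ℕ → ℕ
K₁ r = (3 + r) * (3 + r)
K₂ r = (2 + r) * ((2 + r) * ((2 + r) * (2 + r)) ^ 2)

module Choosing
  (G : Graph) (r : ℕ) (2≤r : 2 ≤ r) (1≤Δ : 1 ≤ maxDegree G)
  (b : ℕ) (0<b : 0 < b) (Δ^≤b³ : maxDegree G ^ suc r ≤ b ^ 3)
  where

  open Graph G using (order; Adj; adj?; adj-irrefl)
  open Walks G
  open Counts 1≤Δ
  private
    V = Vertex G
    Δ = maxDegree G
    vs = allFin order
    h = ⌊ r /2⌋
    m = ⌈ r /2⌉
    T = Δ ^ m
    instance
      T≢0 : NonZero T
      T≢0 = >-nonZero (Δ^-positive m)

  frequentFrom? : ∀ v s → Dec (T < #walks m v s * b)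
  frequentFrom? v s = T <? #walks m v s * b

  frequentTo? : ∀ v s → Dec (T < #walks m s v * b)
  frequentTo? v s = T <? #walks m s v * b

  forbidden : V → List V
  forbidden v = near h v ++ (filter (frequentFrom? v) vs ++ filter (frequentTo? v) vs)

  forbidden-sym : ∀ {v w} → v ≢ w → w ∈ forbidden v → v ∈ forbidden w
  forbidden-sym {v} {w} v≢w w∈ with ∈-++⁻ (near h v) w∈
  ... | inj₁ w∈near = ∈-++⁺ˡ (near-sym h v≢w w∈near)
  ... | inj₂ w∈′ with ∈-++⁻ (filter (frequentFrom? v) vs) w∈′
  ... | inj₁ w∈from = ∈-++⁺ʳ (near h w) (∈-++⁺ʳ (filter (frequentFrom? w) vs)
                        (∈-filter⁺ (frequentTo? w) (∈-allFin v) (∈-filter⁻ (frequentFrom? v) {xs = vs} w∈from .proj₂)))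
  ... | inj₂ w∈to   = ∈-++⁺ʳ (near h w) (∈-++⁺ˡ
                        (∈-filter⁺ (frequentFrom? w) (∈-allFin v) (∈-filter⁻ (frequentTo? v) {xs = vs} w∈to .proj₂)))

  forbidden-≤ : ∀ v → length (forbidden v) ≤ Δ ^ h + (b + b)
  forbidden-≤ v = begin
    length (forbidden v)
      ≡⟨ length-++ (near h v) ⟩
    length (near h v) + length (filter (frequentFrom? v) vs ++ filter (frequentTo? v) vs)
      ≡⟨ cong (length (near h v) +_) (length-++ (filter (frequentFrom? v) vs)) ⟩
    length (near h v) + (length (filter (frequentFrom? v) vs) + length (filter (frequentTo? v) vs))
      ≤⟨ +-mono-≤ (near-≤ h v) (+-mono-≤ (markov vs (#walks m v) T b (∑-#walks-from m v))
                                         (markov vs (λ s → #walks m s v) T b (∑-#walks-to m v))) ⟩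
    Δ ^ h + (b + b) ∎
    where open ≤-Reasoning

  ordinary : V → List V
  ordinary v = filter (λ s → ¬? (frequentFrom? v s)) vs

  pathsAt : V → ℕ → List (List V)
  pathsAt v i = through i (suc r ∸ i) v

  paths : V → List (List V)
  paths v = concatMap (pathsAt v) (upTo (2 + r))

  antipodes : V → V → List (List V)
  antipodes v s = concatMap (λ xs → map (xs ++_) (walks m s v)) (walks m v s)

  partnered : ℕ → List V → V → List (V × Pairs order)
  partnered j zs s = map (s ,_) (pairs j zs)

  -- Kind 0 is a clash with a forbidden partner, kind 1 adds an equation on a closed walk through an
  -- antipode, and kind 2 adds two equations on a path. Walks with repeated vertices are included
  -- too, since only upper bounds on the lists are required.
  conflicts : ℕ → V → List (V × Pairs order)
  conflicts 0 v = map (λ s → s , []) (forbidden v)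
  conflicts 1 v = concatMap (λ s → concatMap (λ zs → partnered 1 zs s) (antipodes v s)) (ordinary v)
  conflicts 2 v = concatMap (λ zs → concatMap (partnered 2 zs) zs) (paths v)
  conflicts _ v = []

  M : ℕ → ℕ
  M 0 = Δ ^ h + (b + b)
  M 1 = K₁ r * b
  M 2 = K₂ r * b
  M _ = 0

  conflicts-length : ∀ j v {s q} → (s , q) ∈ conflicts j v → length q ≡ j
  conflicts-length 0 v p∈ with ∈-map⁻ _ p∈
  ... | _ , _ , refl = refl
  conflicts-length 1 v p∈ with concatMap-∈ _ (ordinary v) p∈
  ... | s , _ , p∈′ with concatMap-∈ _ (antipodes v s) p∈′
  ... | zs , _ , p∈″ with ∈-map⁻ (s ,_) p∈″
  ... | q , q∈ , refl = listsOf-length 1 (cartesianProduct zs zs) q∈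
  conflicts-length 2 v p∈ with concatMap-∈ _ (paths v) p∈
  ... | zs , _ , p∈′ with concatMap-∈ _ zs p∈′
  ... | s , _ , p∈″ with ∈-map⁻ (s ,_) p∈″
  ... | q , q∈ , refl = listsOf-length 2 (cartesianProduct zs zs) q∈
  conflicts-length (suc (suc (suc _))) v ()

  antipodes-≤ : ∀ v s → length (antipodes v s) ≤ #walks m v s * #walks m s v
  antipodes-≤ v s = length-concatMap-≤ _ (walks m v s) λ {xs} _ → ≤-reflexive (length-map (xs ++_) (walks m s v))

  m+m≤1+r : m + m ≤ suc r
  m+m≤1+r = ≤-trans (+-monoˡ-≤ m (⌈n/2⌉≤1+⌊n/2⌋ r)) (≤-reflexive (cong suc (⌊n/2⌋+⌈n/2⌉≡n r)))

  antipodes-length : ∀ v s {zs} → zs ∈ antipodes v s → length zs ≤ 3 + r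
  antipodes-length v s zs∈ with concatMap-∈ _ (walks m v s) zs∈
  ... | xs , xs∈ , zs∈′ with ∈-map⁻ (xs ++_) zs∈′
  ... | ys , ys∈ , refl = begin
    length (xs ++ ys)      ≡⟨ length-++ xs ⟩
    length xs + length ys  ≡⟨ cong₂ _+_ (walks-length m v s xs∈) (walks-length m s v ys∈) ⟩
    suc m + suc m          ≡⟨ cong suc (+-suc m m) ⟩
    2 + (m + m)            ≤⟨ +-monoʳ-≤ 2 m+m≤1+r ⟩
    3 + r                  ∎
    where open ≤-Reasoning

  -- An ordinary `s` is reached by at most T/b walks from `v`, and at most T walks lead back to `v`
  -- in total. Hence the sum is at most T²/b ≤ Δ^(r+1)/b ≤ b².
  ∑-antipodes : ∀ v → ∑ (ordinary v) (λ s → #walks m v s * #walks m s v) ≤ b * b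
  ∑-antipodes v = *-cancelˡ-≤ b {{>-nonZero 0<b}} (begin
    b * ∑ os (λ s → #walks m v s * #walks m s v)
      ≡⟨ ∑-*ˡ b os _ ⟨
    ∑ os (λ s → b * (#walks m v s * #walks m s v))
      ≡⟨ ∑-cong os (λ s → rearrange b (#walks m v s) (#walks m s v)) ⟩
    ∑ os (λ s → #walks m v s * b * #walks m s v)
      ≤⟨ ∑-mono os (λ {s} s∈ → *-monoˡ-≤ (#walks m s v)
           (≮⇒≥ (∈-filter⁻ (λ s → ¬? (frequentFrom? v s)) {xs = vs} s∈ .proj₂))) ⟩
    ∑ os (λ s → T * #walks m s v)
      ≡⟨ ∑-*ˡ T os (λ s → #walks m s v) ⟩
    T * ∑ os (λ s → #walks m s v)
      ≤⟨ *-monoʳ-≤ T (≤-trans (∑-filter-≤ _ vs (λ s → #walks m s v)) (∑-#walks-to m v)) ⟩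
    T * T
      ≡⟨ ^-distribˡ-+-* Δ m m ⟨
    Δ ^ (m + m)
      ≤⟨ ^-monoʳ-≤ Δ {{>-nonZero 1≤Δ}} m+m≤1+r ⟩
    Δ ^ suc r
      ≤⟨ Δ^≤b³ ⟩
    b ^ 3
      ≡⟨ cong (λ c → b * (b * c)) (*-identityʳ b) ⟩
    b * (b * b) ∎)
    where
    open ≤-Reasoning
    os = ordinary v
    rearrange : ∀ b x y → b * (x * y) ≡ x * b * y
    rearrange = solve-∀

  paths-≤ : ∀ v → length (paths v) ≤ (2 + r) * b ^ 3
  paths-≤ v = ≤-trans
    (length-concatMap-≤ (pathsAt v) (upTo (2 + r)) λ {i} i∈ →
      -- Every position of `v` leaves r + 1 steps to choose, hence at most Δ^(r+1) walks.
      ≤-trans (through-≤ i (suc r ∸ i) v) (≤-trans (≤-reflexive (^-monus Δ i r (∈-upTo⁻ i∈))) Δ^≤b³))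
    (≤-reflexive (cong (_* b ^ 3) (length-upTo (2 + r))))

  paths-length : ∀ v {zs} → zs ∈ paths v → length zs ≡ 2 + r
  paths-length v zs∈ with concatMap-∈ _ (upTo (2 + r)) zs∈
  ... | i , i∈ , zs∈′ with ∈-upTo⁻ i∈
  ... | s≤s i≤ = trans (through-length i (suc r ∸ i) v zs∈′) (cong suc (m+[n∸m]≡n i≤))

  conflicts-few : ∀ j v → length (conflicts j v) ≤ M j * b ^ j
  conflicts-few 0 v = begin
    length (conflicts 0 v)  ≡⟨ length-map _ (forbidden v) ⟩
    length (forbidden v)    ≤⟨ forbidden-≤ v ⟩
    M 0                     ≡⟨ *-identityʳ (M 0) ⟨
    M 0 * 1                 ∎
    where open ≤-Reasoning
  conflicts-few 1 v = begin
    length (conflicts 1 v)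
      ≡⟨ length-concatMap _ (ordinary v) ⟩
    ∑ (ordinary v) _
      ≤⟨ ∑-mono (ordinary v) (λ {s} _ → ≤-trans
           (length-concatMap-≤ _ (antipodes v s) λ {zs} zs∈ → ≤-trans (≤-reflexive (length-map (s ,_) (pairs 1 zs)))
              (≤-trans (length-pairs 1 zs (antipodes-length v s zs∈)) (≤-reflexive (*-identityʳ (K₁ r)))))
           (*-monoˡ-≤ (K₁ r) (antipodes-≤ v s))) ⟩
    ∑ (ordinary v) (λ s → #walks m v s * #walks m s v * K₁ r)
      ≡⟨ ∑-*ʳ (K₁ r) (ordinary v) (λ s → #walks m v s * #walks m s v) ⟩
    ∑ (ordinary v) (λ s → #walks m v s * #walks m s v) * K₁ r
      ≤⟨ *-monoˡ-≤ (K₁ r) (∑-antipodes v) ⟩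
    b * b * K₁ r
      ≡⟨ rearrange b (K₁ r) ⟩
    K₁ r * b * (b * 1) ∎
    where
    open ≤-Reasoning
    rearrange : ∀ b k → b * b * k ≡ k * b * (b * 1)
    rearrange = solve-∀
  conflicts-few 2 v = begin
    length (conflicts 2 v)
      ≤⟨ length-concatMap-≤ _ (paths v) (λ {zs} zs∈ → ≤-trans
           (length-concatMap-≤ _ zs λ {s} _ → ≤-trans (≤-reflexive (length-map (s ,_) (pairs 2 zs)))
              (length-pairs 2 zs (≤-reflexive (paths-length v zs∈))))
           (≤-reflexive (cong (_* ((2 + r) * (2 + r)) ^ 2) (paths-length v zs∈)))) ⟩
    length (paths v) * ((2 + r) * ((2 + r) * (2 + r)) ^ 2)
      ≤⟨ *-monoˡ-≤ ((2 + r) * ((2 + r) * (2 + r)) ^ 2) (paths-≤ v) ⟩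
    (2 + r) * b ^ 3 * ((2 + r) * ((2 + r) * (2 + r)) ^ 2)
      ≡⟨ rearrange (2 + r) b (b ^ 2) ((2 + r) * ((2 + r) * (2 + r)) ^ 2) ⟩
    K₂ r * b * b ^ 2 ∎
    where
    open ≤-Reasoning
    rearrange : ∀ n b c e → n * (b * c) * e ≡ n * e * b * c
    rearrange = solve-∀
  conflicts-few (suc (suc (suc _))) v = z≤n

  -- Valid partial colourings

  onX : Subset order → (V → ℕ) → List V → List ℕ
  onX X f xs = map f (filter (_∈ₛ? X) xs)

  -- The allowances 1 and 2 are what may be lost from r + 1 and r + 2 vertices while r colours
  -- remain. Counting repeats only inside `X` makes validity survive deletions.
  Valid : Subset order → (V → ℕ) → Set
  Valid X f =
    (∀ u w → u ∈ₛ X → w ∈ₛ X → u ≢ w → w ∈ forbidden u → f u ≢ f w) ×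
    (∀ (C : Cycle G) → let open Cycle C in length vertices ≡ suc r → repeats (onX X f vertices) ≤ 1) ×
    All (λ xs → Unique xs → Linked Adj xs → repeats (onX X f xs) ≤ 2) (listsOf (2 + r) vs)

  valid? : ∀ X f → Dec (Valid X f)
  valid? X f =
    Fin.all? (λ u → Fin.all? λ w → (u ∈ₛ? X) →-dec ((w ∈ₛ? X) →-dec (¬? (u Fin.≟ w) →-dec
      (any? (w Fin.≟_) (forbidden u) →-dec ¬? (f u ≟ f w))))) ×-dec
    all-cycles? G (λ xs → (length xs ≟ suc r) →-dec (repeats (onX X f xs) ≤? 1)) ×-dec
    All.all? (λ xs → allPairs? (λ x y → ¬? (x Fin.≟ y)) xs →-dec (linked? adj? xs →-dec (repeats (onX X f xs) ≤? 2)))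
             (listsOf (2 + r) vs)

  valid-∅ : ∀ {X f} → (∀ v → v ∉ X) → Valid X f
  valid-∅ {X} {f} none =
    (λ u w u∈ → contradiction u∈ (none u)) ,
    (λ C _ → ≤-trans (no-repeats (Cycle.vertices C)) z≤n) ,
    All.tabulate λ {xs} _ _ _ → ≤-trans (no-repeats xs) z≤n
    where
    no-repeats : ∀ xs → repeats (onX X f xs) ≤ 0
    no-repeats xs = ≤-reflexive (cong (repeats ∘ map f) (filter-none (_∈ₛ? X) (All.tabulate {xs = xs} λ {v} _ → none v)))

  valid-delete : ∀ {X f} t → Valid X f → Valid (X - t) f
  valid-delete {X} {f} t (A , B , C) =
    (λ u w u∈ w∈ → A u w (X-t⊆X u∈) (X-t⊆X w∈)) ,
    (λ C len → ≤-trans (fewer (Cycle.vertices C)) (B C len)) ,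
    All.map (λ {xs} P u l → ≤-trans (fewer xs) (P u l)) C
    where
    X-t⊆X : ∀ {u} → u ∈ₛ X - t → u ∈ₛ X
    X-t⊆X = p─q⊆p X ⁅ t ⁆
    fewer : ∀ xs → repeats (onX (X - t) f xs) ≤ repeats (onX X f xs)
    fewer xs = repeats-⊑ (⊑-map⁺ f (⊆-filter-Sublist (_∈ₛ? (X - t)) (_∈ₛ? X) (λ { refl → X-t⊆X }) (⊑-refl {x = xs})))

  valid-local : ∀ {X f f′} → (∀ u → u ∈ₛ X → f u ≡ f′ u) → Valid X f → Valid X f′
  valid-local {X} {f} {f′} f≡f′ (A , B , C) =
    (λ u w u∈ w∈ u≢w w∈S eq → A u w u∈ w∈ u≢w w∈S (trans (f≡f′ u u∈) (trans eq (sym (f≡f′ w w∈))))) ,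
    (λ C len → ≤-trans (≤-reflexive (sym (same (Cycle.vertices C)))) (B C len)) ,
    All.map (λ {xs} P u l → ≤-trans (≤-reflexive (sym (same xs))) (P u l)) C
    where
    same : ∀ xs → repeats (onX X f xs) ≡ repeats (onX X f′ xs)
    same xs = cong repeats (map-cong-local (All.tabulate λ u∈ → f≡f′ _ (∈-filter⁻ (_∈ₛ? X) {xs = xs} u∈ .proj₂)))

  kinds : List ℕ
  kinds = 0 ∷ 1 ∷ 2 ∷ []

  module _ {X v f} (v∈X : v ∈ₛ X) (valid : Valid (X - v) f)
    (none : ∀ {j s q} → j ∈ kinds → (s , q) ∈ conflicts j v → Elim ((v , s) ∷ q) → ¬ Sat f ((v , s) ∷ q)) where

    not-forbidden : ∀ {s} → s ∈ forbidden v → v ≢ s → f v ≢ f s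
    not-forbidden s∈ v≢s fv≡fs = none (here refl) (∈-map⁺ _ s∈) (v≢s , [] , _) (fv≡fs ∷ [])

    extend-A : ∀ u w → u ∈ₛ X → w ∈ₛ X → u ≢ w → w ∈ forbidden u → f u ≢ f w
    extend-A u w u∈ w∈ u≢w w∈S with u Fin.≟ v | w Fin.≟ v
    ... | yes refl | _        = not-forbidden w∈S u≢w
    ... | no u≢v   | yes refl = not-forbidden (forbidden-sym u≢w w∈S) (u≢w ∘ sym) ∘ sym
    ... | no u≢v   | no w≢v   =
      valid .proj₁ u w (x∈p∧x≢y⇒x∈p-y u∈ u≢v) (x∈p∧x≢y⇒x∈p-y w∈ w≢v) u≢w w∈S

    -- A new repeat equates `v` with some `s` on the cycle. If an arc between them is short, or if
    -- `s` is frequent, then `s` is forbidden; otherwise the two arcs are half-walks and the second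
    -- equation completes a conflict of kind 1.
    extend-B : ∀ (C : Cycle G) → let open Cycle C in length vertices ≡ suc r → repeats (onX X f vertices) ≤ 1
    extend-B C len = ≮⇒≥ λ 1< → conclude (new-repeat f X v 1 vertices distinct 1< (valid .proj₂ .proj₁ C len))
      where
      open Cycle C
      conclude : _ → ⊥
      conclude (v∈ , s , q , |q|≡1 , s∈ , within , elim@(v≢s , _) , sat@(fv≡fs ∷ _)) with arcs C v∈ s∈
      ... | a , b , xs , ys , a+b≡ , v⇝s , s⇝v , ⊆arcs with short-arc r a b (≤-reflexive (trans a+b≡ len))
      ... | inj₁ a≤h        = not-forbidden (∈-++⁺ˡ (walk⇒near a h v s v⇝s a≤h v≢s)) v≢s fv≡fs
      ... | inj₂ (inj₁ b≤h) =
        not-forbidden (∈-++⁺ˡ (near-sym h (v≢s ∘ sym) (walk⇒near b h s v s⇝v b≤h (v≢s ∘ sym)))) v≢s fv≡fs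
      ... | inj₂ (inj₂ (refl , refl , _)) with frequentFrom? v s
      ... | yes freq =
        not-forbidden (∈-++⁺ʳ (near h v) (∈-++⁺ˡ (∈-filter⁺ (frequentFrom? v) (∈-allFin s) freq))) v≢s fv≡fs
      ... | no ¬freq = none (there (here refl))
        (∈-concatMap _ (∈-filter⁺ (λ s → ¬? (frequentFrom? v s)) (∈-allFin s) ¬freq)
          (∈-concatMap _ (∈-concatMap _ (walk∈walks v⇝s) (∈-map⁺ (xs ++_) (walk∈walks s⇝v)))
            (∈-map⁺ (s ,_) (within⇒∈pairs |q|≡1 (within-⊆ ⊆arcs within)))))
        elim sat

    -- A third repeat on the path provides the equation at `v` and two more. Splitting the path at
    -- `v` determines the position under which it was enumerated.
    extend-C : ∀ {xs} → length xs ≡ 2 + r → (Unique xs → Linked Adj xs → repeats (onX (X - v) f xs) ≤ 2) →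
               Unique xs → Linked Adj xs → repeats (onX X f xs) ≤ 2
    extend-C {xs} len few u l = ≮⇒≥ λ 2< → conclude (new-repeat f X v 2 xs u 2< (few u l))
      where
      conclude : _ → ⊥
      conclude (v∈ , s , q , |q|≡2 , s∈ , within , elim , sat) with ∈-∃++ v∈
      ... | as , bs , refl = none (there (there (here refl)))
        (∈-concatMap (λ zs → concatMap (partnered 2 zs) zs)
          (∈-concatMap (pathsAt v) (∈-upTo⁺ i<)
            (subst (λ ℓ → xs ∈ through (length as) ℓ v) |bs|≡ (linked∈through as v bs l)))
          (∈-concatMap (partnered 2 xs) s∈ (∈-map⁺ (s ,_) (within⇒∈pairs |q|≡2 within))))
        elim sat
        where
        |as|+|bs| : length as + length bs ≡ suc r
        |as|+|bs| = cong pred (trans (sym (+-suc (length as) (length bs))) (trans (sym (length-++ as)) len))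
        i< : length as < 2 + r
        i< = s≤s (≤-trans (m≤m+n _ _) (≤-reflexive |as|+|bs|))
        |bs|≡ : length bs ≡ suc r ∸ length as
        |bs|≡ = trans (sym (m+n∸m≡n (length as) (length bs))) (cong (_∸ length as) |as|+|bs|)

    valid-extend : Valid X f
    valid-extend = extend-A , extend-B ,
      All.tabulate λ xs∈ → extend-C (listsOf-length (2 + r) vs xs∈) (All.lookup (valid .proj₂ .proj₂) xs∈)

  -- The candidate conflicts form a finite list and are decidable: either one occurs, or
  -- `valid-extend` contradicts invalidity.
  conflict : ∀ {X v f} → v ∈ₛ X → Valid (X - v) f → ¬ Valid X f →
     ∃[ j ] ∃[ s ] ∃[ q ] j ∈ kinds × (s , q) ∈ conflicts j v × Elim ((v , s) ∷ q) × Sat f ((v , s) ∷ q)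
  conflict {X} {v} {f} v∈X valid ¬valid with any? (λ j → any? occurs? (conflicts j v)) kinds
    where
    occurs? : ∀ ((s , q) : V × Pairs order) → Dec (Elim ((v , s) ∷ q) × Sat f ((v , s) ∷ q))
    occurs? (s , q) = elim? ((v , s) ∷ q) ×-dec All.all? (λ (t , s) → f t ≟ f s) ((v , s) ∷ q)
  ... | no none = contradiction (valid-extend v∈X valid λ j∈ p∈ elim sat → none (lose j∈ (lose p∈ (elim , sat)))) ¬valid
  ... | yes some with find some
  ... | j , j∈ , some′ with find some′
  ... | (s , q) , p∈ , elim , sat = j , s , q , j∈ , p∈ , elim , sat

  valid⇒acyclic : ∀ {f} → Valid full f → IsAcyclicColoring r G f
  valid⇒acyclic {f} (A , B , C) = proper , many
    where
    differ : ∀ u w → u ≢ w → w ∈ forbidden u → f u ≢ f w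
    differ u w = A u w ∈⊤ ∈⊤

    proper : IsProper G f
    -- Neighbours are at distance 1, which is at most ⌊r/2⌋ because r ≥ 2.
    proper {u} {v} uv = differ u v u≢v (∈-++⁺ˡ (walk⇒near 1 h u v (step uv stop) (⌊n/2⌋-mono 2≤r) u≢v))
      where
      u≢v : u ≢ v
      u≢v u≡v = adj-irrefl u≡v uv

    onX-full : ∀ xs → onX full f xs ≡ map f xs
    onX-full xs = cong (map f) (filter-all (_∈ₛ? full) (All.tabulate {xs = xs} λ _ → ∈⊤))

    rainbow : ∀ C → let open Cycle C in length vertices ≤ r → repeats (map f vertices) ≤ 0
    rainbow C len≤r = ≮⇒≥ λ 0< → conclude (repeats⇒elim f 1 vertices distinct 0<)
      where
      open Cycle C
      conclude : _ → ⊥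
      conclude (((t , s) ∷ []) , refl , (t≢s , _) , fv≡fs ∷ [] , (t∈ , s∈) ∷ []) with arcs C t∈ s∈
      ... | a , b , xs , ys , a+b≡ , t⇝s , s⇝t , _ with short-arc r a b (≤-trans (≤-reflexive a+b≡) (m≤n⇒m≤1+n len≤r))
      ... | inj₁ a≤h        = differ t s t≢s (∈-++⁺ˡ (walk⇒near a h t s t⇝s a≤h t≢s)) fv≡fs
      ... | inj₂ (inj₁ b≤h) = differ s t (t≢s ∘ sym) (∈-++⁺ˡ (walk⇒near b h s t s⇝t b≤h (t≢s ∘ sym))) (sym fv≡fs)
      -- Two long arcs would need a cycle of length r + 1, but this one has at most r vertices.
      ... | inj₂ (inj₂ (_ , _ , a+b≡1+r)) = 1+n≰n (≤-trans (≤-reflexive (trans (sym a+b≡1+r) a+b≡)) len≤r)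

    colours : ∀ xs {j} → repeats (map f xs) ≤ j → length xs ≤ card (map f xs) + j
    colours xs ≤j = ≤-trans (≤-reflexive (sym (length-map f xs)))
      (≤-trans (length≤card+repeats (map f xs)) (+-monoʳ-≤ (card (map f xs)) ≤j))

    many : ∀ D → let open Cycle D in length vertices ⊓ r ≤ card (map f vertices)
    many D with <-cmp (length vertices) (suc r)
      where open Cycle D
    ... | tri< (s≤s len≤r) _ _ = ≤-trans (m⊓n≤m (length vertices) r)
      (≤-trans (colours vertices (rainbow D len≤r)) (≤-reflexive (+-identityʳ _)))
      where open Cycle D
    ... | tri≈ _ len≡ _ = ≤-trans (m⊓n≤n (length vertices) r) (+-cancelʳ-≤ 1 r _
      (≤-trans (≤-reflexive (trans (+-comm r 1) (sym len≡)))
               (colours vertices (subst (λ cs → repeats cs ≤ 1) (onX-full vertices) (B D len≡)))))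
      where open Cycle D
    ... | tri> _ _ 2+r≤ = begin
      length vertices ⊓ r    ≤⟨ m⊓n≤n (length vertices) r ⟩
      r                      ≤⟨ +-cancelʳ-≤ 2 r (card (map f xs)) r+2≤ ⟩
      card (map f xs)        ≤⟨ card-⊆ image-⊆ ⟩
      card (map f vertices)  ∎
      where
      open Cycle D
      open ≤-Reasoning
      -- An initial path of r + 2 vertices already shows r colours. The closing edge is not part of
      -- it, so a cycle of exactly r + 2 vertices needs no separate case.
      xs = take (2 + r) vertices
      |xs|≡ : length xs ≡ 2 + r
      |xs|≡ = trans (length-take (2 + r) vertices) (m≤n⇒m⊓n≡m 2+r≤)
      xs∈ : xs ∈ listsOf (2 + r) vs
      xs∈ = subst (λ ℓ → xs ∈ listsOf ℓ vs) |xs|≡ (∈-listsOf vs xs λ {v} _ → ∈-allFin v)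
      linked : Linked Adj xs
      linked = linked-++ˡ xs (subst (Linked Adj) (sym (take++drop≡id (2 + r) vertices)) (linked-++ˡ vertices closed))
      image-⊆ : ∀ {c} → c ∈ map f xs → c ∈ map f vertices
      image-⊆ c∈ with ∈-map⁻ f c∈
      ... | x , x∈ , refl = ∈-map⁺ f (subst (x ∈_) (take++drop≡id (2 + r) vertices) (∈-++⁺ˡ x∈))
      r+2≤ : r + 2 ≤ card (map f xs) + 2
      r+2≤ = begin
        r + 2                ≡⟨ +-comm r 2 ⟩
        2 + r                ≡⟨ |xs|≡ ⟨
        length xs            ≤⟨ colours xs (subst (λ cs → repeats cs ≤ 2) (onX-full xs)
                                  (All.lookup C xs∈ (unique-take⁺ (2 + r) distinct) linked)) ⟩
        card (map f xs) + 2  ∎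

  -- The lists are first cut to a common length, because the counting argument uses one value of
  -- `k`; the chosen `k` satisfies `room` with equality.
  choosable : IsAcyclicChoosable r G (b + ∑ kinds M)
  choosable L L-card = from-sublists C.valid-exists
    where
    sub : ∀ v → ∃[ ys ] length ys ≡ b + ∑ kinds M × Unique ys × (∀ {y} → y ∈ ys → y ∈ L v)
    sub v = sublist-of-card (b + ∑ kinds M) (L v) (L-card v)
    L′ : V → List ℕ
    L′ v = sub v .proj₁
    module C = Counting {k = b + ∑ kinds M} 0<b L′ (λ v → sub v .proj₂ .proj₂ .proj₁) (λ v → sub v .proj₂ .proj₁)
      Valid valid? valid-∅ valid-delete valid-local kinds M ≤-refl conflicts conflicts-length conflicts-few conflict
    from-sublists : ∃[ f ] (∀ v → f v ∈ L′ v) × Valid full f →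
                    ∃[ f ] (∀ v → f v ∈ L v) × IsAcyclicColoring r G f
    from-sublists (f , f∈ , valid) = f , (λ v → sub v .proj₂ .proj₂ .proj₂ (f∈ v)) , valid⇒acyclic valid

-- Cube roots and the final bound

cube-* : ∀ x y → (x * y) ^ 3 ≡ x ^ 3 * y ^ 3
cube-* = expanded
  where
  expanded : ∀ x y → x * y * (x * y * (x * y * 1)) ≡ x * (x * (x * 1)) * (y * (y * (y * 1)))
  expanded = solve-∀

-- The least `b` with n ≤ b³ works: for b ≥ 2 minimality gives (b - 1)³ ≤ n, and b ≤ 2(b - 1). For b
-- = 1 that doubling fails, and 1 ≤ n is used directly.
cube-root : ∀ n → 1 ≤ n → ∃[ b ] 0 < b × n ≤ b ^ 3 × b ^ 3 ≤ 8 * n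
cube-root n 1≤n with least (λ b → n ≤? b ^ 3) n (m≤m^n n)
  where
  m≤m^n : ∀ n → n ≤ n ^ 3
  m≤m^n zero    = z≤n
  m≤m^n (suc n) = m≤m*n (suc n) (suc n ^ 2) {{>-nonZero (m^n>0 (suc n) 2)}}
... | zero , _ , n≤0 , _ = contradiction (≤-trans 1≤n n≤0) 1+n≰n
... | 1 , _ , n≤1 , _ = 1 , s≤s z≤n , n≤1 , ≤-trans 1≤n (m≤n*m n 8)
... | suc (suc c) , _ , n≤ , least-b = suc (suc c) , s≤s z≤n , n≤ , (begin
  (2 + c) ^ 3          ≤⟨ ^-monoˡ-≤ 3 2+c≤ ⟩
  (2 * (1 + c)) ^ 3    ≡⟨ cube-* 2 (1 + c) ⟩
  8 * (1 + c) ^ 3      ≤⟨ *-monoʳ-≤ 8 (≰⇒≥ λ n≤c → 1+n≰n (least-b (suc c) n≤c)) ⟩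
  8 * n                ∎)
  where
  open ≤-Reasoning
  2+c≤ : 2 + c ≤ 2 * (1 + c)
  2+c≤ = ≤-trans (s≤s (m≤m+n (suc c) (c + 0))) (≤-reflexive (cong suc (sym (+-suc c (c + 0)))))

theorem9 : ∀ (r : ℕ) → 4 ≤ r →
    ∃[ c ] (∀ (G : Graph) → 3 ≤ maxDegree G →
    ∃[ a ] (IsAcyclicChoiceNumber r G a ×
    ((a ∸ maxDegree G ^ ⌊ r /2⌋) ≲ c · maxDegree G ^[ (r + 1) / 3 ])))
theorem9 r 4≤r = 2 * K , bound
  where
  -- `K` collects the coefficients of `b`: one for the growth rate, two for the frequent partners,
  -- and one constant for each of the other kinds. The factor 2 in the witness is the cube root of
  -- the 8 lost in `cube-root`.
  K = 3 + K₁ r + K₂ r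
  2≤r : 2 ≤ r
  2≤r = ≤-trans (s≤s (s≤s z≤n)) 4≤r

  bound : ∀ (G : Graph) → 3 ≤ maxDegree G →
    ∃[ a ] (IsAcyclicChoiceNumber r G a ×
    ((a ∸ maxDegree G ^ ⌊ r /2⌋) ≲ 2 * K · maxDegree G ^[ (r + 1) / 3 ]))
  bound G 3≤Δ = finish (cube-root (Δ ^ suc r) (m^n>0 Δ {{Δ≢0}} (suc r)))
    where
    Δ = maxDegree G
    1≤Δ : 1 ≤ Δ
    1≤Δ = ≤-trans (s≤s z≤n) 3≤Δ
    Δ≢0 : NonZero Δ
    Δ≢0 = >-nonZero 1≤Δ

    finish : ∃[ b ] 0 < b × Δ ^ suc r ≤ b ^ 3 × b ^ 3 ≤ 8 * Δ ^ suc r →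
             ∃[ a ] (IsAcyclicChoiceNumber r G a × ((a ∸ Δ ^ ⌊ r /2⌋) ≲ 2 * K · Δ ^[ (r + 1) / 3 ]))
    finish (b , 0<b , Δ≤b³ , b³≤8Δ) = minimal (least (choosable? G r) _ (Choosing.choosable G r 2≤r 1≤Δ b 0<b Δ≤b³))
      where
      excess : ∀ b d k l → b + (d + (b + b) + (k * b + (l * b + 0))) ≡ d + (3 + k + l) * b
      excess = solve-∀

      minimal : ∃[ a ] a ≤ b + (Δ ^ ⌊ r /2⌋ + (b + b) + (K₁ r * b + (K₂ r * b + 0))) × IsAcyclicChoiceNumber r G a → _
      minimal (a , a≤ , min) = a , min , (begin
        (a ∸ Δ ^ ⌊ r /2⌋) ^ 3
          ≤⟨ ^-monoˡ-≤ 3 (m≤n+o⇒m∸n≤o a (Δ ^ ⌊ r /2⌋)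
               (≤-trans a≤ (≤-reflexive (excess b (Δ ^ ⌊ r /2⌋) (K₁ r) (K₂ r))))) ⟩
        (K * b) ^ 3
          ≡⟨ cube-* K b ⟩
        K ^ 3 * b ^ 3
          ≤⟨ *-monoʳ-≤ (K ^ 3) b³≤8Δ ⟩
        K ^ 3 * (8 * Δ ^ suc r)
          ≡⟨ *-assoc (K ^ 3) 8 (Δ ^ suc r) ⟨
        K ^ 3 * 8 * Δ ^ suc r
          ≡⟨ cong₂ _*_ (trans (*-comm (K ^ 3) 8) (sym (cube-* 2 K))) (cong (Δ ^_) (+-comm 1 r)) ⟩
        (2 * K) ^ 3 * Δ ^ (r + 1) ∎)
        where open ≤-Reasoning
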